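{- Let $h\colon \mathbb{Z}_+\times\mathbb{P}\to\{0,1\}$ be an arbitrary function. Let $g$ be the function on the positive integers defined by $g(1)=0$ and, for an integer $u>1$ with prime factorization $u=\prod_{i=1}^r p_i^{\alpha_i}$, by $g(u)=\sum_{i=1}^r h(\alpha_i,p_i)$. Let $Q(x;h)$ be the number of integers $n$ between $1$ and $x$ such that $g(n)=0$. Then the limit $\lim_{x\to\infty} Q(x;h)/x$ exists and $$\lim_{x\to\infty}\frac{Q(x;h)}{x}=\prod_{p}\left(1-\frac{p-1}{p}\sum_{i=1}^{\infty}\frac{h(i,p)}{p^i}\right),$$ where the product is over all primes $p$.
   Context: $\mathbb{Z}_+$ denotes the set of positive integers and $\mathbb{P}$ the set of prime numbers. In a prime factorization $u=\prod_{i=1}^r p_i^{\alpha_i}$ the primes $p_1,\dots,p_r$ are distinct and the exponents satisfy $\alpha_i\ge 1$. The infinite product over primes is understood as the limit, as $y\to\infty$, of the finite products over primes $p\le y$ (its value may be $0$). -}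

module Defs where

open import Axiom.ExcludedMiddle using (ExcludedMiddle)
open import Data.Fin.Base as Fin using (Fin)
open import Data.Integer.Base as ℤ using (+_; -[1+_])
import Data.Integer.Properties as ℤₚ
open import Data.Irrelevant using ([_])
open import Data.List.Base
  using (List; []; _∷_; length; filter; deduplicate; mapMaybe; applyUpTo; foldr; map)
open import Data.List.Membership.Propositional using (_∈_)
open import Data.List.Membership.Propositional.Properties
  using (∈-filter⁺; ∈-filter⁻; ∈-applyUpTo⁺)
import Data.List.Relation.Unary.All as All
open import Data.Maybe.Base using (Maybe; just; nothing)
open import Data.Nat.Base as ℕ using (ℕ; zero; suc)
open import Data.Nat.ListAction using (sum)
open import Data.Nat.Primality using (Prime; prime?; prime⇒nonZero)
open import Data.Nat.Primality.Factorisation using (PrimeFactorisation; factorise)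
import Data.Nat.Properties as ℕₚ
open import Data.Product.Base using (∃-syntax; _×_; _,_; proj₁; proj₂)
open import Data.Rational.Base as ℚ using (ℚ; 0ℚ; 1ℚ; mkℚ)
import Data.Rational.Properties as ℚₚ
open import Data.Rational.Solver using (module +-*-Solver)
import Data.Rational.Unnormalised.Base as ℚᵘ
import Data.Rational.Unnormalised.Properties as ℚᵘₚ
open import Data.Refinement as Refinement using (Refinement-syntax; _,_; value)
open import Data.Sum.Base using (inj₁; inj₂)
open import Level using (0ℓ)
open import Relation.Binary.Definitions using (DecidableEquality)
open import Relation.Binary.PropositionalEquality
  using (_≡_; refl; sym; trans; cong; subst)
open import Relation.Nullary using (¬_; Dec; yes; no; contradiction)

pos* : ∀ {p q} → 0ℚ ℚ.< p → 0ℚ ℚ.< q → 0ℚ ℚ.< p ℚ.* q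
pos* {p} {q} p>0 q>0 = ℚₚ.positive⁻¹ (p ℚ.* q)
  {{ℚₚ.pos*pos⇒pos p {{ℚ.positive p>0}} q {{ℚ.positive q>0}}}}

half : ∀ {ε} → 0ℚ ℚ.< ε → 0ℚ ℚ.< ℚ.½ ℚ.* ε
half = pos* (ℚₚ.positive⁻¹ ℚ.½)

halves : ∀ ε → ℚ.½ ℚ.* ε ℚ.+ ℚ.½ ℚ.* ε ≡ ε
halves ε = trans (sym (ℚₚ.*-distribʳ-+ ε ℚ.½ ℚ.½)) (ℚₚ.*-identityˡ ε)

*-mono-≤ : ∀ {p q r s} → 0ℚ ℚ.≤ q → 0ℚ ℚ.≤ r → p ℚ.≤ q → r ℚ.≤ s → p ℚ.* r ℚ.≤ q ℚ.* s
*-mono-≤ {q = q} {r} q≥0 r≥0 p≤q r≤s = ℚₚ.≤-trans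
  (ℚₚ.*-monoʳ-≤-nonNeg r {{ℚ.nonNegative r≥0}} p≤q)
  (ℚₚ.*-monoˡ-≤-nonNeg q {{ℚ.nonNegative q≥0}} r≤s)

shrink : ∀ {ε b} → 0ℚ ℚ.< ε → 0ℚ ℚ.< b → ∃[ δ ] 0ℚ ℚ.< δ × b ℚ.* δ ≡ ε
shrink {ε} {b} ε>0 b>0 = b⁻¹ ℚ.* ε , pos* b⁻¹>0 ε>0 , eq
  where
  instance
    b-pos : ℚ.Positive b
    b-pos = ℚ.positive b>0
    b≢0 : ℚ.NonZero b
    b≢0 = ℚₚ.pos⇒nonZero b
  b⁻¹ = ℚ.1/ b
  b⁻¹>0 : 0ℚ ℚ.< b⁻¹
  b⁻¹>0 = ℚₚ.positive⁻¹ b⁻¹ {{ℚₚ.1/pos⇒pos b}}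
  eq : b ℚ.* (b⁻¹ ℚ.* ε) ≡ ε
  eq = trans (sym (ℚₚ.*-assoc b b⁻¹ ε))
         (trans (cong (ℚ._* ε) (ℚₚ.*-inverseʳ b)) (ℚₚ.*-identityˡ ε))

p≤∣p∣ : ∀ p → p ℚ.≤ ℚ.∣ p ∣
p≤∣p∣ p with ℚₚ.≤-total 0ℚ p
... | inj₁ p≥0 = ℚₚ.≤-reflexive (sym (ℚₚ.0≤p⇒∣p∣≡p p≥0))
... | inj₂ p≤0 = ℚₚ.≤-trans p≤0 (ℚₚ.0≤∣p∣ p)

∣∣p∣-∣q∣∣≤∣p-q∣ : ∀ p q → ℚ.∣ ℚ.∣ p ∣ ℚ.- ℚ.∣ q ∣ ∣ ℚ.≤ ℚ.∣ p ℚ.- q ∣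
∣∣p∣-∣q∣∣≤∣p-q∣ p q with ℚₚ.∣p∣≡p∨∣p∣≡-p (ℚ.∣ p ∣ ℚ.- ℚ.∣ q ∣)
... | inj₁ eq = subst (ℚ._≤ ℚ.∣ p ℚ.- q ∣) (sym eq) (le p q)
  where
  le : ∀ p q → ℚ.∣ p ∣ ℚ.- ℚ.∣ q ∣ ℚ.≤ ℚ.∣ p ℚ.- q ∣
  le p q = begin
    ℚ.∣ p ∣ ℚ.- ℚ.∣ q ∣
      ≡⟨ cong (λ z → ℚ.∣ z ∣ ℚ.- ℚ.∣ q ∣)
           (solve 2 (λ p q → p := (p :- q) :+ q) refl p q) ⟩
    ℚ.∣ (p ℚ.- q) ℚ.+ q ∣ ℚ.- ℚ.∣ q ∣
      ≤⟨ ℚₚ.+-monoˡ-≤ (ℚ.- ℚ.∣ q ∣) (ℚₚ.∣p+q∣≤∣p∣+∣q∣ (p ℚ.- q) q) ⟩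
    (ℚ.∣ p ℚ.- q ∣ ℚ.+ ℚ.∣ q ∣) ℚ.- ℚ.∣ q ∣
      ≡⟨ solve 2 (λ a b → (a :+ b) :- b := a) refl ℚ.∣ p ℚ.- q ∣ ℚ.∣ q ∣ ⟩
    ℚ.∣ p ℚ.- q ∣ ∎
    where
    open ℚₚ.≤-Reasoning
    open +-*-Solver
... | inj₂ eq = begin
    ℚ.∣ ℚ.∣ p ∣ ℚ.- ℚ.∣ q ∣ ∣
      ≡⟨ eq ⟩
    ℚ.- (ℚ.∣ p ∣ ℚ.- ℚ.∣ q ∣)
      ≡⟨ solve 2 (λ a b → :- (a :- b) := b :- a) refl ℚ.∣ p ∣ ℚ.∣ q ∣ ⟩
    ℚ.∣ q ∣ ℚ.- ℚ.∣ p ∣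
      ≡⟨ cong (λ z → ℚ.∣ z ∣ ℚ.- ℚ.∣ p ∣)
           (solve 2 (λ p q → q := (q :- p) :+ p) refl p q) ⟩
    ℚ.∣ (q ℚ.- p) ℚ.+ p ∣ ℚ.- ℚ.∣ p ∣
      ≤⟨ ℚₚ.+-monoˡ-≤ (ℚ.- ℚ.∣ p ∣) (ℚₚ.∣p+q∣≤∣p∣+∣q∣ (q ℚ.- p) p) ⟩
    (ℚ.∣ q ℚ.- p ∣ ℚ.+ ℚ.∣ p ∣) ℚ.- ℚ.∣ p ∣
      ≡⟨ solve 2 (λ a b → (a :+ b) :- b := a) refl ℚ.∣ q ℚ.- p ∣ ℚ.∣ p ∣ ⟩
    ℚ.∣ q ℚ.- p ∣
      ≡⟨ cong ℚ.∣_∣ (solve 2 (λ p q → q :- p := :- (p :- q)) refl p q) ⟩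
    ℚ.∣ ℚ.- (p ℚ.- q) ∣
      ≡⟨ ℚₚ.∣-p∣≡∣p∣ (p ℚ.- q) ⟩
    ℚ.∣ p ℚ.- q ∣ ∎
    where
    open ℚₚ.≤-Reasoning
    open +-*-Solver

*-close : ∀ a b c d {B D δ δ′} → 0ℚ ℚ.< B → 0ℚ ℚ.< D → ℚ.∣ a ∣ ℚ.≤ B → ℚ.∣ d ∣ ℚ.≤ D →
          ℚ.∣ a ℚ.- c ∣ ℚ.< δ → ℚ.∣ b ℚ.- d ∣ ℚ.< δ′ →
          ℚ.∣ a ℚ.* b ℚ.- c ℚ.* d ∣ ℚ.< B ℚ.* δ′ ℚ.+ D ℚ.* δ
*-close a b c d {B} {D} {δ} {δ′} B>0 D>0 a≤B d≤D ac<δ bd<δ′ = begin-strict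
  ℚ.∣ a ℚ.* b ℚ.- c ℚ.* d ∣
    ≡⟨ cong ℚ.∣_∣ (solve 4 (λ a b c d →
         a :* b :- c :* d := a :* (b :- d) :+ d :* (a :- c)) refl a b c d) ⟩
  ℚ.∣ a ℚ.* (b ℚ.- d) ℚ.+ d ℚ.* (a ℚ.- c) ∣
    ≤⟨ ℚₚ.∣p+q∣≤∣p∣+∣q∣ (a ℚ.* (b ℚ.- d)) (d ℚ.* (a ℚ.- c)) ⟩
  ℚ.∣ a ℚ.* (b ℚ.- d) ∣ ℚ.+ ℚ.∣ d ℚ.* (a ℚ.- c) ∣
    ≡⟨ cong (ℚ._+ ℚ.∣ d ℚ.* (a ℚ.- c) ∣) (ℚₚ.∣p*q∣≡∣p∣*∣q∣ a (b ℚ.- d)) ⟩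
  ℚ.∣ a ∣ ℚ.* ℚ.∣ b ℚ.- d ∣ ℚ.+ ℚ.∣ d ℚ.* (a ℚ.- c) ∣
    ≡⟨ cong (ℚ.∣ a ∣ ℚ.* ℚ.∣ b ℚ.- d ∣ ℚ.+_) (ℚₚ.∣p*q∣≡∣p∣*∣q∣ d (a ℚ.- c)) ⟩
  ℚ.∣ a ∣ ℚ.* ℚ.∣ b ℚ.- d ∣ ℚ.+ ℚ.∣ d ∣ ℚ.* ℚ.∣ a ℚ.- c ∣
    ≤⟨ ℚₚ.+-mono-≤
         (ℚₚ.*-monoʳ-≤-nonNeg ℚ.∣ b ℚ.- d ∣ {{ℚₚ.∣-∣-nonNeg (b ℚ.- d)}} a≤B)
         (ℚₚ.*-monoʳ-≤-nonNeg ℚ.∣ a ℚ.- c ∣ {{ℚₚ.∣-∣-nonNeg (a ℚ.- c)}} d≤D) ⟩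
  B ℚ.* ℚ.∣ b ℚ.- d ∣ ℚ.+ D ℚ.* ℚ.∣ a ℚ.- c ∣
    <⟨ ℚₚ.+-mono-< (ℚₚ.*-monoʳ-<-pos B {{ℚ.positive B>0}} bd<δ′)
                   (ℚₚ.*-monoʳ-<-pos D {{ℚ.positive D>0}} ac<δ) ⟩
  B ℚ.* δ′ ℚ.+ D ℚ.* δ ∎
  where
  open ℚₚ.≤-Reasoning
  open +-*-Solver

-- The value at 0 is arbitrary: a sequence representing a positive real may
-- vanish at finitely many indices.
recip : ℚ → ℚ
recip q with q ℚₚ.≟ 0ℚ
... | yes _  = 0ℚ
... | no q≢0 = ℚ.1/_ q {{ℚ.≢-nonZero q≢0}}

*-recip : ∀ {q} → 0ℚ ℚ.< q → q ℚ.* recip q ≡ 1ℚ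
*-recip {q} q>0 with q ℚₚ.≟ 0ℚ
... | yes q≡0 = contradiction (sym q≡0) (ℚₚ.<⇒≢ q>0)
... | no q≢0  = ℚₚ.*-inverseʳ q {{ℚ.≢-nonZero q≢0}}

recip>0 : ∀ {q} → 0ℚ ℚ.< q → 0ℚ ℚ.< recip q
recip>0 {q} q>0 with q ℚₚ.≟ 0ℚ
... | yes q≡0 = contradiction (sym q≡0) (ℚₚ.<⇒≢ q>0)
... | no q≢0  = ℚₚ.positive⁻¹ _ {{ℚₚ.1/pos⇒pos q {{ℚ.positive q>0}}}}

recip-close : ∀ a b {η ε} → 0ℚ ℚ.< η → 0ℚ ℚ.< ε → η ℚ.≤ a → η ℚ.≤ b →
              ℚ.∣ b ℚ.- a ∣ ℚ.< ε ℚ.* (η ℚ.* η) → ℚ.∣ recip a ℚ.- recip b ∣ ℚ.< ε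
recip-close a b {η} {ε} η>0 ε>0 η≤a η≤b close = go (recip a) (recip b)
  (*-recip a>0) (*-recip b>0) (pos* (recip>0 a>0) (recip>0 b>0))
  where
  open ℚₚ.≤-Reasoning
  open +-*-Solver
  a>0 : 0ℚ ℚ.< a
  a>0 = ℚₚ.<-≤-trans η>0 η≤a
  b>0 : 0ℚ ℚ.< b
  b>0 = ℚₚ.<-≤-trans η>0 η≤b
  go : ∀ u v → a ℚ.* u ≡ 1ℚ → b ℚ.* v ≡ 1ℚ → 0ℚ ℚ.< u ℚ.* v → ℚ.∣ u ℚ.- v ∣ ℚ.< ε
  go u v au≡1 bv≡1 uv>0 = begin-strict
    ℚ.∣ u ℚ.- v ∣
      ≡⟨ cong ℚ.∣_∣ (trans
           (trans (cong (ℚ._- v) (trans (sym (ℚₚ.*-identityʳ u)) (cong (u ℚ.*_) (sym bv≡1))))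
                  (cong (λ t → u ℚ.* (b ℚ.* v) ℚ.- t)
                    (trans (sym (ℚₚ.*-identityʳ v)) (cong (v ℚ.*_) (sym au≡1)))))
           (solve 4 (λ a b u v → u :* (b :* v) :- v :* (a :* u) := (u :* v) :* (b :- a)) refl
             a b u v)) ⟩
    ℚ.∣ (u ℚ.* v) ℚ.* (b ℚ.- a) ∣
      ≡⟨ ℚₚ.∣p*q∣≡∣p∣*∣q∣ (u ℚ.* v) (b ℚ.- a) ⟩
    ℚ.∣ u ℚ.* v ∣ ℚ.* ℚ.∣ b ℚ.- a ∣
      ≡⟨ cong (ℚ._* ℚ.∣ b ℚ.- a ∣) (ℚₚ.0≤p⇒∣p∣≡p (ℚₚ.<⇒≤ uv>0)) ⟩
    (u ℚ.* v) ℚ.* ℚ.∣ b ℚ.- a ∣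
      <⟨ ℚₚ.*-monoʳ-<-pos (u ℚ.* v) {{ℚ.positive uv>0}} close ⟩
    (u ℚ.* v) ℚ.* (ε ℚ.* (η ℚ.* η))
      ≤⟨ ℚₚ.*-monoˡ-≤-nonNeg (u ℚ.* v) {{ℚ.nonNegative (ℚₚ.<⇒≤ uv>0)}}
           (ℚₚ.*-monoˡ-≤-nonNeg ε {{ℚ.nonNegative (ℚₚ.<⇒≤ ε>0)}}
             (*-mono-≤ (ℚₚ.<⇒≤ a>0) (ℚₚ.<⇒≤ η>0) η≤a η≤b)) ⟩
    (u ℚ.* v) ℚ.* (ε ℚ.* (a ℚ.* b))
      ≡⟨ solve 5 (λ a b u v e → (u :* v) :* (e :* (a :* b)) := (a :* u) :* ((b :* v) :* e)) refl
           a b u v ε ⟩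
    (a ℚ.* u) ℚ.* ((b ℚ.* v) ℚ.* ε)
      ≡⟨ trans (cong (ℚ._* ((b ℚ.* v) ℚ.* ε)) au≡1) (ℚₚ.*-identityˡ _) ⟩
    (b ℚ.* v) ℚ.* ε
      ≡⟨ trans (cong (ℚ._* ε) bv≡1) (ℚₚ.*-identityˡ ε) ⟩
    ε ∎

numerator-bound : ∀ q m → ℤ.∣ ℚ.↥ q ∣ ℕ.≤ m → q ℚ.≤ + m ℚ./ 1
numerator-bound q@record{} m le = ℚₚ.toℚᵘ-cancel-≤
  (ℚᵘₚ.≤-respʳ-≃ (ℚᵘₚ.≃-sym (ℚₚ.toℚᵘ-fromℚᵘ (ℚᵘ.mkℚᵘ (+ m) 0))) (ℚᵘ.*≤* (begin
    ℚ.↥ q ℤ.* + 1       ≡⟨ ℤₚ.*-identityʳ (ℚ.↥ q) ⟩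
    ℚ.↥ q               ≤⟨ i≤+∣i∣ (ℚ.↥ q) ⟩
    + ℤ.∣ ℚ.↥ q ∣       ≤⟨ ℤ.+≤+ le ⟩
    + m                 ≤⟨ ℤ.+≤+ (ℕₚ.m≤m*n m (ℚ.↧ₙ q)) ⟩
    + (m ℕ.* ℚ.↧ₙ q)    ≡⟨ ℤₚ.pos-* m (ℚ.↧ₙ q) ⟩
    + m ℤ.* ℚ.↧ q       ∎)))
  where
  open ℤₚ.≤-Reasoning
  i≤+∣i∣ : ∀ i → i ℤ.≤ + ℤ.∣ i ∣
  i≤+∣i∣ (+ n)    = ℤₚ.≤-refl
  i≤+∣i∣ -[1+ n ] = ℤ.-≤+

-- Real numbers, as Cauchy sequences of rationals.  Distinct sequences
-- may represent the same real; the definitions below only involve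
-- order and limits, which do not depend on the representative.

IsCauchy : (ℕ → ℚ) → Set
IsCauchy a = ∀ ε → 0ℚ ℚ.< ε →
  ∃[ N ] (∀ m n → N ℕ.≤ m → N ℕ.≤ n → ℚ.∣ a m ℚ.- a n ∣ ℚ.< ε)

record ℝ : Set where
  constructor mkℝ
  field
    seq    : ℕ → ℚ
    cauchy : IsCauchy seq

open ℝ public

infix 4 _<_ _≤_

_<_ : ℝ → ℝ → Set
x < y = ∃[ ε ] 0ℚ ℚ.< ε × ∃[ N ] (∀ n → N ℕ.≤ n → seq x n ℚ.+ ε ℚ.≤ seq y n)

_≤_ : ℝ → ℝ → Set
x ≤ y = ¬ (y < x)

fromℚ : ℚ → ℝ
fromℚ q = mkℝ (λ _ → q) λ ε ε>0 → 0 , λ _ _ _ _ →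
  subst (λ d → ℚ.∣ d ∣ ℚ.< ε) (sym (ℚₚ.+-inverseʳ q)) ε>0

fromℕ : ℕ → ℝ
fromℕ n = fromℚ (+ n ℚ./ 1)

0ℝ 1ℝ : ℝ
0ℝ = fromℚ 0ℚ
1ℝ = fromℚ 1ℚ

eventuallyBounded : ∀ x → ∃[ b ] 0ℚ ℚ.< b × ∃[ N ] (∀ n → N ℕ.≤ n → ℚ.∣ seq x n ∣ ℚ.≤ b)
eventuallyBounded x with cauchy x 1ℚ (ℚₚ.positive⁻¹ 1ℚ)
... | N , close = 1ℚ ℚ.+ ℚ.∣ a ∣ , b>0 , N , bound
  where
  a = seq x N
  b>0 : 0ℚ ℚ.< 1ℚ ℚ.+ ℚ.∣ a ∣
  b>0 = ℚₚ.+-mono-<-≤ (ℚₚ.positive⁻¹ 1ℚ) (ℚₚ.0≤∣p∣ a)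
  open ℚₚ.≤-Reasoning
  open +-*-Solver
  bound : ∀ n → N ℕ.≤ n → ℚ.∣ seq x n ∣ ℚ.≤ 1ℚ ℚ.+ ℚ.∣ a ∣
  bound n N≤n = begin
    ℚ.∣ seq x n ∣
      ≡⟨ cong ℚ.∣_∣ (solve 2 (λ p q → p := (p :- q) :+ q) refl (seq x n) a) ⟩
    ℚ.∣ (seq x n ℚ.- a) ℚ.+ a ∣
      ≤⟨ ℚₚ.∣p+q∣≤∣p∣+∣q∣ (seq x n ℚ.- a) a ⟩
    ℚ.∣ seq x n ℚ.- a ∣ ℚ.+ ℚ.∣ a ∣
      ≤⟨ ℚₚ.+-monoˡ-≤ ℚ.∣ a ∣ (ℚₚ.<⇒≤ (close n N N≤n ℕₚ.≤-refl)) ⟩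
    1ℚ ℚ.+ ℚ.∣ a ∣ ∎

infixl 6 _+_ _-_
infixl 7 _*_
infix  8 -_

_+_ : ℝ → ℝ → ℝ
x + y = mkℝ (λ n → seq x n ℚ.+ seq y n) c
  where
  open ℚₚ.≤-Reasoning
  open +-*-Solver
  c : IsCauchy (λ n → seq x n ℚ.+ seq y n)
  c ε ε>0 with cauchy x _ (half ε>0) | cauchy y _ (half ε>0)
  ... | M , cx | N , cy = M ℕ.⊔ N , λ m n m≥ n≥ → begin-strict
    ℚ.∣ (seq x m ℚ.+ seq y m) ℚ.- (seq x n ℚ.+ seq y n) ∣
      ≡⟨ cong ℚ.∣_∣ (solve 4 (λ a b c d → (a :+ b) :- (c :+ d) := (a :- c) :+ (b :- d)) refl
           (seq x m) (seq y m) (seq x n) (seq y n)) ⟩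
    ℚ.∣ (seq x m ℚ.- seq x n) ℚ.+ (seq y m ℚ.- seq y n) ∣
      ≤⟨ ℚₚ.∣p+q∣≤∣p∣+∣q∣ (seq x m ℚ.- seq x n) (seq y m ℚ.- seq y n) ⟩
    ℚ.∣ seq x m ℚ.- seq x n ∣ ℚ.+ ℚ.∣ seq y m ℚ.- seq y n ∣
      <⟨ ℚₚ.+-mono-< (cx m n (ℕₚ.m⊔n≤o⇒m≤o M N m≥) (ℕₚ.m⊔n≤o⇒m≤o M N n≥))
                     (cy m n (ℕₚ.m⊔n≤o⇒n≤o M N m≥) (ℕₚ.m⊔n≤o⇒n≤o M N n≥)) ⟩
    ℚ.½ ℚ.* ε ℚ.+ ℚ.½ ℚ.* ε
      ≡⟨ halves ε ⟩
    ε ∎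

-_ : ℝ → ℝ
- x = mkℝ (λ n → ℚ.- seq x n) c
  where
  open +-*-Solver
  c : IsCauchy (λ n → ℚ.- seq x n)
  c ε ε>0 with cauchy x ε ε>0
  ... | N , cx = N , λ m n m≥ n≥ → subst (ℚ._< ε)
    (trans (sym (ℚₚ.∣-p∣≡∣p∣ (seq x m ℚ.- seq x n)))
      (cong ℚ.∣_∣ (solve 2 (λ a b → :- (a :- b) := (:- a) :- (:- b)) refl (seq x m) (seq x n))))
    (cx m n m≥ n≥)

_-_ : ℝ → ℝ → ℝ
x - y = x + (- y)

_*_ : ℝ → ℝ → ℝ
x * y = mkℝ (λ n → seq x n ℚ.* seq y n) c
  where
  c : IsCauchy (λ n → seq x n ℚ.* seq y n)
  c ε ε>0 =
    let
      bx , bx>0 , K , x≤ = eventuallyBounded x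
      by , by>0 , L , y≤ = eventuallyBounded y
      δy , δy>0 , bxδy   = shrink (half ε>0) bx>0
      δx , δx>0 , byδx   = shrink (half ε>0) by>0
      M , cx = cauchy x δx δx>0
      N , cy = cauchy y δy δy>0
    in (K ℕ.⊔ L) ℕ.⊔ (M ℕ.⊔ N) , λ m n m≥ n≥ →
    let
      K≤m  = ℕₚ.m⊔n≤o⇒m≤o K L (ℕₚ.m⊔n≤o⇒m≤o (K ℕ.⊔ L) (M ℕ.⊔ N) m≥)
      L≤n  = ℕₚ.m⊔n≤o⇒n≤o K L (ℕₚ.m⊔n≤o⇒m≤o (K ℕ.⊔ L) (M ℕ.⊔ N) n≥)
      MN≤m = ℕₚ.m⊔n≤o⇒n≤o (K ℕ.⊔ L) (M ℕ.⊔ N) m≥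
      MN≤n = ℕₚ.m⊔n≤o⇒n≤o (K ℕ.⊔ L) (M ℕ.⊔ N) n≥
    in subst (ℚ.∣ seq x m ℚ.* seq y m ℚ.- seq x n ℚ.* seq y n ∣ ℚ.<_)
         (trans (cong (ℚ._+ by ℚ.* δx) bxδy)
           (trans (cong (ℚ.½ ℚ.* ε ℚ.+_) byδx) (halves ε)))
         (*-close (seq x m) (seq y m) (seq x n) (seq y n) bx>0 by>0 (x≤ m K≤m) (y≤ n L≤n)
           (cx m n (ℕₚ.m⊔n≤o⇒m≤o M N MN≤m) (ℕₚ.m⊔n≤o⇒m≤o M N MN≤n))
           (cy m n (ℕₚ.m⊔n≤o⇒n≤o M N MN≤m) (ℕₚ.m⊔n≤o⇒n≤o M N MN≤n)))

∣_∣ : ℝ → ℝ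
∣ x ∣ = mkℝ (λ n → ℚ.∣ seq x n ∣) c
  where
  c : IsCauchy (λ n → ℚ.∣ seq x n ∣)
  c ε ε>0 with cauchy x ε ε>0
  ... | N , cx = N , λ m n m≥ n≥ →
    ℚₚ.≤-<-trans (∣∣p∣-∣q∣∣≤∣p-q∣ (seq x m) (seq x n)) (cx m n m≥ n≥)

inverse : ∀ x → 0ℝ < x → ℝ
inverse x (η , η>0 , K , x≥η) = mkℝ (λ n → recip (seq x n)) c
  where
  η≤ : ∀ n → K ℕ.≤ n → η ℚ.≤ seq x n
  η≤ n n≥ = subst (ℚ._≤ seq x n) (ℚₚ.+-identityˡ η) (x≥η n n≥)
  c : IsCauchy (λ n → recip (seq x n))
  c ε ε>0 =
    let N , cx = cauchy x (ε ℚ.* (η ℚ.* η)) (pos* ε>0 (pos* η>0 η>0))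
    in K ℕ.⊔ N , λ m n m≥ n≥ → recip-close (seq x m) (seq x n) η>0 ε>0
         (η≤ m (ℕₚ.m⊔n≤o⇒m≤o K N m≥)) (η≤ n (ℕₚ.m⊔n≤o⇒m≤o K N n≥))
         (cx n m (ℕₚ.m⊔n≤o⇒n≤o K N n≥) (ℕₚ.m⊔n≤o⇒n≤o K N m≥))

infixl 7 _÷_[_]

_÷_[_] : ℝ → ∀ y → 0ℝ < y → ℝ
x ÷ y [ y>0 ] = x * inverse y y>0

Limit : (ℕ → ℝ) → ℝ → Set
Limit a L = ∀ ε → 0ℝ < ε → ∃[ N ] (∀ n → N ℕ.≤ n → ∣ a n - L ∣ < ε)

Limit∞ : (∀ x → 0ℝ < x → ℝ) → ℝ → Set
Limit∞ f L = ∀ ε → 0ℝ < ε → ∃[ X ] (∀ x (x>0 : 0ℝ < x) → X ≤ x → ∣ f x x>0 - L ∣ < ε)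

-- The proofs are irrelevant, so a function on ℙ depends on the number only.
ℤ₊ ℙ : Set
ℤ₊ = [ n ∈ ℕ ∣ ℕ.NonZero n ]
ℙ  = [ p ∈ ℕ ∣ Prime p ]

1+_ : ℕ → ℤ₊
1+ n = suc n , [ _ ]

partialSum : (ℤ₊ → ℝ) → ℕ → ℝ
partialSum a zero    = 0ℝ
partialSum a (suc n) = partialSum a n + a (1+ n)

HasSum : (ℤ₊ → ℝ) → ℝ → Set
HasSum a s = Limit (partialSum a) s

-- Any natural number above x would do; integersUpTo x lists each n with
-- 1 ≤ n ≤ x exactly once.
crudeBound : ℝ → ℕ
crudeBound x = ℤ.∣ ℚ.↥ (proj₁ (eventuallyBounded x) ℚ.+ 1ℚ) ∣

atMost? : ExcludedMiddle 0ℓ → ∀ x (n : ℤ₊) → Dec (fromℕ (value n) ≤ x)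
atMost? em x n = em

integersUpTo : ExcludedMiddle 0ℓ → ℝ → List ℤ₊
integersUpTo em x = filter (atMost? em x) (applyUpTo 1+_ (crudeBound x))

≤crudeBound : ∀ n x → fromℕ n ≤ x → n ℕ.≤ crudeBound x
≤crudeBound n x n≤x with n ℕₚ.≤? crudeBound x
... | yes n≤b = n≤b
... | no n≰b  = contradiction
  (1ℚ , ℚₚ.positive⁻¹ 1ℚ , N , λ k N≤k → ℚₚ.≤-trans
    (ℚₚ.+-monoˡ-≤ 1ℚ (ℚₚ.≤-trans (p≤∣p∣ (seq x k)) (below k N≤k)))
    (numerator-bound _ n (ℕₚ.<⇒≤ (ℕₚ.≰⇒> n≰b))))
  n≤x
  where
  N     = proj₁ (proj₂ (proj₂ (eventuallyBounded x)))
  below = proj₂ (proj₂ (proj₂ (eventuallyBounded x)))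

∈-integersUpTo⁺ : ∀ (em : ExcludedMiddle 0ℓ) x (n : ℤ₊) →
                  fromℕ (value n) ≤ x → n ∈ integersUpTo em x
∈-integersUpTo⁺ em x n@(suc _ , _) n≤x =
  ∈-filter⁺ (atMost? em x) (∈-applyUpTo⁺ 1+_ (≤crudeBound (value n) x n≤x)) n≤x

∈-integersUpTo⁻ : ∀ (em : ExcludedMiddle 0ℓ) x (n : ℤ₊) →
                  n ∈ integersUpTo em x → fromℕ (value n) ≤ x
∈-integersUpTo⁻ em x n n∈ =
  proj₂ (∈-filter⁻ (atMost? em x) {xs = applyUpTo 1+_ (crudeBound x)} n∈)

_≟_ : DecidableEquality ℙ
_≟_ = Refinement._≟_ ℕₚ._≟_

asPrime : ℤ₊ → Maybe ℙ
asPrime (n , _) with prime? n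
... | yes p-prime = just (n , [ p-prime ])
... | no  _       = nothing

primesUpTo : ExcludedMiddle 0ℓ → ℝ → List ℙ
primesUpTo em y = mapMaybe asPrime (integersUpTo em y)

-- With repetitions.
primeFactors : ℤ₊ → List ℙ
primeFactors (n , [ n≢0 ]) =
  All.reduce (λ {p} p-prime → p , [ p-prime ]) (PrimeFactorisation.factorsPrime (factorise n {{n≢0}}))

exponent : ℤ₊ → ℙ → ℕ
exponent u p = length (filter (p ≟_) (primeFactors u))

module _ (h : ℤ₊ × ℙ → Fin 2) where

  -- h, extended by 0 to the exponent 0 (which does not occur in g).
  h₀ : ℕ → ℙ → ℕ
  h₀ zero    p = 0
  h₀ (suc α) p = Fin.toℕ (h (1+ α , p))

  g : ℤ₊ → ℕ
  g u = sum (map (λ p → h₀ (exponent u p) p) (deduplicate _≟_ (primeFactors u)))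

  Q : ExcludedMiddle 0ℓ → ℝ → ℕ
  Q em x = length (filter (λ n → g n ℕₚ.≟ 0) (integersUpTo em x))

  term : ℙ → ℤ₊ → ℝ
  term p@(q , [ q-prime ]) i = fromℚ
    (ℚ._/_ (+ Fin.toℕ (h (i , p))) (q ℕ.^ value i)
      {{ℕₚ.m^n≢0 q (value i) {{prime⇒nonZero q-prime}}}})

factor : ℙ → ℝ → ℝ
factor (p , [ p-prime ]) s =
  1ℝ - fromℚ (ℚ._/_ (+ (p ℕ.∸ 1)) p {{prime⇒nonZero p-prime}}) * s

product : (ℙ → ℝ) → List ℙ → ℝ
product f ps = foldr _*_ 1ℝ (map f ps)

{-# OPTIONS --safe #-}

-- Sieve by primes q ≤ n and exponents i ≤ n only: the integers m such that no
-- such pair with h(i,q) = 1 has qⁱ exactly dividing m form a set whose counting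
-- function differs from density n · N by a bounded amount, where density n is
-- the truncated Euler product.  The truncated densities decrease to a limit L,
-- and up to N the sieve at level N is g = 0.
--
-- Passing from level n to level N multiplies the density by at most 1/(1 + S)
-- and removes at most 2 N S integers, where S is the total mass of the new
-- pairs.  Hence (integers removed) · density N ≤ 2 N (density n − density N).
-- If L > 0 this is o(N) by convergence of the densities; if L = 0 the upper
-- bound from the sieve suffices.

module Submission where

open import Defs hiding (_+_; _-_; -_; _*_; _<_; _≤_; ∣_∣; *-mono-≤; _≟_)
import Defs as Real
open import Axiom.ExcludedMiddle using (ExcludedMiddle)
open import Data.Fin.Base using (Fin; toℕ)
open import Data.Fin.Properties using (toℕ≤pred[n])
open import Data.Integer.Base as ℤ using (ℤ)
import Data.Integer.Properties as ℤₚ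
open import Data.Irrelevant using ([_])
open import Data.List.Base
  using (List; []; _∷_; _++_; length; filter; deduplicate; mapMaybe; applyUpTo; map)
open import Data.List.Membership.Propositional using (_∈_)
open import Data.List.Membership.Propositional.Properties using (∈-deduplicate⁺; ∈-deduplicate⁻)
open import Data.List.Properties
  using (applyUpTo-∷ʳ; ++-identityʳ; filter-++; filter-accept; filter-reject; length-++; mapMaybe-++)
open import Data.List.Relation.Unary.All as All using (All; []; _∷_)
open import Data.List.Relation.Unary.Any using (here; there)
open import Data.Nat.Base as ℕ using (ℕ; zero; suc; NonZero; _^_)
open import Data.Nat.Coprimality using (Coprime; coprime-divisor)
open import Data.Nat.DivMod using (m≡m%n+[m/n]*n; m%n<n)
open import Data.Nat.Divisibility
  using (_∣_; _∣?_; ∣m+n∣m⇒∣n; >⇒∤; n∣m*n; m∣m*n; ∣-trans; ∣m⇒∣m*n; ∣n⇒∣m*n; ∣1⇒≡1; 1∣_; *-monoʳ-∣; *-cancelˡ-∣; ∣⇒≤)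
open import Data.Nat.ListAction using (sum) renaming (product to ∏ₗ)
open import Data.Nat.Primality
  using (Prime; prime?; euclidsLemma; prime⇒irreducible; prime⇒nonZero; prime⇒nonTrivial; ¬prime[0]; ¬prime[1])
open import Data.Nat.Primality.Factorisation using (PrimeFactorisation; factorise)
import Data.Nat.Properties as ℕₚ
open import Data.Product.Base using (∃-syntax; Σ-syntax; _×_; _,_; proj₁; proj₂)
open import Data.Rational.Base hiding (NonZero; truncate; floor; _÷_)
open import Data.Rational.Properties
open import Data.Rational.Solver using (module +-*-Solver)
import Data.Rational.Unnormalised.Base as ℚᵘ
import Data.Rational.Unnormalised.Properties as ℚᵘₚ
open import Data.Refinement using (value; _,_)
open import Data.Sum.Base using (_⊎_; inj₁; inj₂; [_,_]′)
open import Function.Base using (_∘_; id)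
open import Level using (0ℓ)
open import Relation.Binary.PropositionalEquality hiding ([_])
open import Relation.Nullary using (¬_; Dec; yes; no; contradiction)
open import Relation.Nullary.Decidable using (recompute)
open +-*-Solver

-- Rational arithmetic

-- The obstacle is that the masses of all pairs may have a divergent sum (as for h constantly 1), so
-- a bare union bound over the new pairs need not become small. The density pays for it: for masses
-- 0 ≤ a ≤ b ≤ 1 one has (1 - b)(1 + (b - a)) ≤ 1 - a, hence R (1 + S) ≤ P for the new product R and
-- the old product P, and S can be large only where R is small. The error of the bounded-error count
-- depends on n, so n stays fixed while N grows. The passage from n to N uses one-sided bounds
-- without error terms, which may be added over all primes up to N. They have the form N/qⁱ, while
-- exact divisibility by qⁱ has density (1 - 1/q)/qⁱ, at least half of 1/qⁱ: hence the 2 in 2 N S.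
-- Exact divisibility enters as a difference of consecutive weights, and (p - 1)/p · 1/pⁱ = 1/pⁱ -
-- 1/pⁱ⁺¹ turns the Euler factor of the theorem into the same form.

0≤⇒≤ : ∀ {p q d} → 0ℚ ≤ d → q ≡ p + d → p ≤ q
0≤⇒≤ {p} {d = d} 0≤d refl = subst (_≤ p + d) (+-identityʳ p) (+-monoʳ-≤ p 0≤d)

p≤q⇒0≤q-p : ∀ {p q} → p ≤ q → 0ℚ ≤ q - p
p≤q⇒0≤q-p {p} {q} p≤q = subst (_≤ q - p) (+-inverseʳ p) (+-monoˡ-≤ (- p) p≤q)

+-0≤ : ∀ {p q} → 0ℚ ≤ p → 0ℚ ≤ q → 0ℚ ≤ p + q
+-0≤ = +-mono-≤

*-0≤ : ∀ {p q} → 0ℚ ≤ p → 0ℚ ≤ q → 0ℚ ≤ p * q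
*-0≤ {p} {q} 0≤p 0≤q = subst (_≤ p * q) (*-zeroʳ p) (*-monoˡ-≤-nonNeg p {{nonNegative 0≤p}} 0≤q)

*-monoˡ-≤-0≤ : ∀ {p q r} → 0ℚ ≤ r → p ≤ q → r * p ≤ r * q
*-monoˡ-≤-0≤ {r = r} 0≤r = *-monoˡ-≤-nonNeg r {{nonNegative 0≤r}}

*-monoʳ-≤-0≤ : ∀ {p q r} → 0ℚ ≤ r → p ≤ q → p * r ≤ q * r
*-monoʳ-≤-0≤ {r = r} 0≤r = *-monoʳ-≤-nonNeg r {{nonNegative 0≤r}}

0≤1 : 0ℚ ≤ 1ℚ
0≤1 = <⇒≤ (positive⁻¹ 1ℚ)

∣p∣≤ : ∀ {p b} → p ≤ b → - p ≤ b → ∣ p ∣ ≤ b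
∣p∣≤ {p} {b} p≤b -p≤b with ∣p∣≡p∨∣p∣≡-p p
... | inj₁ eq = subst (_≤ b) (sym eq) p≤b
... | inj₂ eq = subst (_≤ b) (sym eq) -p≤b

-p≤∣p∣ : ∀ p → - p ≤ ∣ p ∣
-p≤∣p∣ p = subst (- p ≤_) (∣-p∣≡∣p∣ p) (p≤∣p∣ (- p))

∣p-q∣≡∣q-p∣ : ∀ p q → ∣ p - q ∣ ≡ ∣ q - p ∣
∣p-q∣≡∣q-p∣ p q = trans (sym (∣-p∣≡∣p∣ (p - q)))
  (cong ∣_∣ (solve 2 (λ p q → :- (p :- q) := q :- p) refl p q))

-- Opaque, since a transparent ι blocks unification on gcd computations.
opaque
  ι : ℕ → ℚ
  ι n = ℤ.+ n / 1

  /-*-ι : ∀ a n .{{_ : NonZero n}} → (ℤ.+ a / n) * ι n ≡ ι a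
  /-*-ι a n@(suc n-1) = toℚᵘ-injective (begin-equality
    toℚᵘ ((ℤ.+ a / n) * ι n)                 ≃⟨ toℚᵘ-homo-* (ℤ.+ a / n) (ι n) ⟩
    toℚᵘ (ℤ.+ a / n) ℚᵘ.* toℚᵘ (ι n)
      ≃⟨ ℚᵘₚ.*-cong (toℚᵘ-fromℚᵘ (ℚᵘ.mkℚᵘ (ℤ.+ a) n-1)) (toℚᵘ-fromℚᵘ (ℚᵘ.mkℚᵘ (ℤ.+ n) 0)) ⟩
    ℚᵘ.mkℚᵘ (ℤ.+ a) n-1 ℚᵘ.* ℚᵘ.mkℚᵘ (ℤ.+ n) 0
      ≃⟨ ℚᵘ.*≡* (trans (ℤₚ.*-identityʳ _) (cong (ℤ.+ a ℤ.*_) (cong ℤ.+_ (sym (ℕₚ.*-identityʳ n))))) ⟩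
    ℚᵘ.mkℚᵘ (ℤ.+ a) 0                        ≃⟨ toℚᵘ-fromℚᵘ (ℚᵘ.mkℚᵘ (ℤ.+ a) 0) ⟨
    toℚᵘ (ι a)                               ∎)
    where open ℚᵘₚ.≤-Reasoning

  ι-+ : ∀ m n → ι (m ℕ.+ n) ≡ ι m + ι n
  ι-+ m n = toℚᵘ-injective (begin-equality
    toℚᵘ (ι (m ℕ.+ n))                       ≃⟨ toℚᵘ-fromℚᵘ (ℚᵘ.mkℚᵘ (ℤ.+ (m ℕ.+ n)) 0) ⟩
    ℚᵘ.mkℚᵘ (ℤ.+ (m ℕ.+ n)) 0
      ≃⟨ ℚᵘ.*≡* (cong (ℤ._* ℤ.+ 1) (sym (cong₂ ℤ._+_ (ℤₚ.*-identityʳ (ℤ.+ m)) (ℤₚ.*-identityʳ (ℤ.+ n))))) ⟩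
    ℚᵘ.mkℚᵘ (ℤ.+ m) 0 ℚᵘ.+ ℚᵘ.mkℚᵘ (ℤ.+ n) 0
      ≃⟨ ℚᵘₚ.+-cong (toℚᵘ-fromℚᵘ (ℚᵘ.mkℚᵘ (ℤ.+ m) 0)) (toℚᵘ-fromℚᵘ (ℚᵘ.mkℚᵘ (ℤ.+ n) 0)) ⟨
    toℚᵘ (ι m) ℚᵘ.+ toℚᵘ (ι n)               ≃⟨ toℚᵘ-homo-+ (ι m) (ι n) ⟨
    toℚᵘ (ι m + ι n)                         ∎)
    where open ℚᵘₚ.≤-Reasoning

  ι-0 : ι 0 ≡ 0ℚ
  ι-0 = refl

  ι-1 : ι 1 ≡ 1ℚ
  ι-1 = refl

  ι-def : ∀ n → ℤ.+ n / 1 ≡ ι n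
  ι-def n = refl

ι-suc : ∀ n → ι (suc n) ≡ ι n + 1ℚ
ι-suc n = trans (ι-+ 1 n) (trans (cong (_+ ι n) ι-1) (+-comm 1ℚ (ι n)))

ι-* : ∀ m n → ι (m ℕ.* n) ≡ ι m * ι n
ι-* zero    n = trans ι-0 (trans (sym (*-zeroˡ (ι n))) (cong (_* ι n) (sym ι-0)))
ι-* (suc m) n = begin
  ι (n ℕ.+ m ℕ.* n)    ≡⟨ ι-+ n (m ℕ.* n) ⟩
  ι n + ι (m ℕ.* n)    ≡⟨ cong (ι n +_) (ι-* m n) ⟩
  ι n + ι m * ι n      ≡⟨ solve 2 (λ m n → n :+ m :* n := (m :+ con 1ℚ) :* n) refl (ι m) (ι n) ⟩
  (ι m + 1ℚ) * ι n     ≡⟨ cong (_* ι n) (ι-suc m) ⟨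
  ι (suc m) * ι n      ∎
  where open ≡-Reasoning

ι≥0 : ∀ n → 0ℚ ≤ ι n
ι≥0 zero    = ≤-reflexive (sym ι-0)
ι≥0 (suc n) = subst (0ℚ ≤_) (sym (ι-suc n)) (+-0≤ (ι≥0 n) 0≤1)

ι-mono : ∀ {m n} → m ℕ.≤ n → ι m ≤ ι n
ι-mono {m} {n} m≤n = 0≤⇒≤ (ι≥0 (n ℕ.∸ m)) (trans (cong ι (sym (ℕₚ.m+[n∸m]≡n m≤n))) (ι-+ m (n ℕ.∸ m)))

ι>0 : ∀ n .{{_ : NonZero n}} → 0ℚ < ι n
ι>0 (suc n) = <-≤-trans (subst (0ℚ <_) (sym ι-1) (positive⁻¹ 1ℚ)) (ι-mono {1} (ℕ.s≤s ℕ.z≤n))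

archimedean : ∀ b {ε} → 0ℚ < ε → ∃[ k ] b ≤ ι k * ε
archimedean b {ε} ε>0 = m , (begin
  b                   ≡⟨ *-identityʳ b ⟨
  b * 1ℚ              ≡⟨ cong (b *_) (*-recip ε>0) ⟨
  b * (ε * recip ε)   ≡⟨ solve 3 (λ b e r → b :* (e :* r) := (b :* r) :* e) refl b ε (recip ε) ⟩
  b * recip ε * ε
    ≤⟨ *-monoʳ-≤-0≤ (<⇒≤ ε>0) (≤-trans (numerator-bound (b * recip ε) m ℕₚ.≤-refl) (≤-reflexive (ι-def m))) ⟩
  ι m * ε             ∎)
  where
  -- The denominator of b / ε is at least 1, so its absolute numerator bounds it from above.
  m = ℤ.∣ ↥ (b * recip ε) ∣
  open ≤-Reasoning

-- Monotonicity yields no rate of convergence, so excluded middle decides at each stage whether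
-- another drop by ε follows.
antitone⇒cauchy : ExcludedMiddle 0ℓ → (f : ℕ → ℚ) →
                  (∀ {m n} → m ℕ.≤ n → f n ≤ f m) → (∀ n → 0ℚ ≤ f n) → IsCauchy f
antitone⇒cauchy em f anti f≥0 ε ε>0 = let k , f0≤kε = archimedean (f 0) ε>0 in
  -- With `suc k` in place of k the inequality is strict, so `suc k` drops would push f below 0.
  finish (subst (f 0 <_) (cong (_* ε) (sym (ι-suc k))) (begin-strict
    f 0               ≤⟨ f0≤kε ⟩
    ι k * ε           ≡⟨ +-identityʳ _ ⟨
    ι k * ε + 0ℚ      <⟨ +-monoʳ-< (ι k * ε) ε>0 ⟩
    ι k * ε + ε       ≡⟨ solve 2 (λ k e → k :* e :+ e := (k :+ con 1ℚ) :* e) refl (ι k) ε ⟩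
    (ι k + 1ℚ) * ε    ∎)) (search (suc k))
  where
  open ≤-Reasoning
  Settled : ℕ → Set
  Settled N = ¬ (∃[ n ] N ℕ.≤ n × f n + ε ≤ f N)

  -- Each failure to settle costs ε, and f is bounded below.
  search : ∀ k → (∃[ N ] Settled N) ⊎ (∃[ N ] f N + ι k * ε ≤ f 0)
  search zero = inj₂ (0 , ≤-reflexive (trans (cong (λ k → f 0 + k * ε) ι-0) (solve 2 (λ a e → a :+ con 0ℚ :* e := a) refl (f 0) ε)))
  search (suc k) with search k
  ... | inj₁ found = inj₁ found
  ... | inj₂ (N , le) with em {∃[ n ] N ℕ.≤ n × f n + ε ≤ f N}
  ...   | no settled = inj₁ (N , settled)
  ...   | yes (n , _ , drop) = inj₂ (n , (begin
    f n + ι (suc k) * ε     ≡⟨ cong (λ t → f n + t * ε) (ι-suc k) ⟩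
    f n + (ι k + 1ℚ) * ε
      ≡⟨ solve 3 (λ a k e → a :+ (k :+ con 1ℚ) :* e := (a :+ e) :+ k :* e) refl (f n) (ι k) ε ⟩
    f n + ε + ι k * ε       ≤⟨ +-monoˡ-≤ (ι k * ε) drop ⟩
    f N + ι k * ε           ≤⟨ le ⟩
    f 0                     ∎))

  near : ∀ {N} → Settled N → ∀ {m n} → N ℕ.≤ m → m ℕ.≤ n → ∣ f m - f n ∣ < ε
  near {N} settled {m} {n} N≤m m≤n = begin-strict
    ∣ f m - f n ∣    ≡⟨ 0≤p⇒∣p∣≡p (p≤q⇒0≤q-p (anti m≤n)) ⟩
    f m - f n        ≤⟨ +-monoˡ-≤ (- f n) (anti N≤m) ⟩
    f N - f n        <⟨ +-monoˡ-< (- f n) (≰⇒> λ le → settled (n , ℕₚ.≤-trans N≤m m≤n , le)) ⟩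
    f n + ε - f n    ≡⟨ solve 2 (λ a e → a :+ e :- a := e) refl (f n) ε ⟩
    ε                ∎

  finish : ∀ {k} → f 0 < ι k * ε → (∃[ N ] Settled N) ⊎ (∃[ N ] f N + ι k * ε ≤ f 0) →
           ∃[ N ] (∀ m n → N ℕ.≤ m → N ℕ.≤ n → ∣ f m - f n ∣ < ε)
  finish {k} lt (inj₂ (N , le)) = contradiction
    (≤-trans (0≤⇒≤ (f≥0 N) (+-comm (f N) (ι k * ε))) le) (λ le′ → <-irrefl refl (<-≤-trans lt le′))
  finish lt (inj₁ (N , settled)) = N , λ m n N≤m N≤n → case m n N≤m N≤n (ℕₚ.≤-total m n)
    where
    case : ∀ m n → N ℕ.≤ m → N ℕ.≤ n → m ℕ.≤ n ⊎ n ℕ.≤ m → ∣ f m - f n ∣ < ε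
    case m n N≤m N≤n (inj₁ m≤n) = near settled N≤m m≤n
    case m n N≤m N≤n (inj₂ n≤m) = subst (_< ε) (∣p-q∣≡∣q-p∣ (f n) (f m)) (near settled N≤n n≤m)

-- Sums, products and mean values

Σ₁ ∏₁ : (ℕ → ℚ) → ℕ → ℚ
Σ₁ f zero    = 0ℚ
Σ₁ f (suc n) = Σ₁ f n + f (suc n)
∏₁ f zero    = 1ℚ
∏₁ f (suc n) = ∏₁ f n * f (suc n)

private variable
  f f′ : ℕ → ℚ
  m n : ℕ

Σ₁-cong : (∀ i → i ℕ.< n → f (suc i) ≡ f′ (suc i)) → Σ₁ f n ≡ Σ₁ f′ n
Σ₁-cong {zero}  eq = refl
Σ₁-cong {suc n} eq = cong₂ _+_ (Σ₁-cong (λ i i<n → eq i (ℕₚ.m<n⇒m<1+n i<n))) (eq n ℕₚ.≤-refl)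

∏₁-cong : (∀ i → i ℕ.< n → f (suc i) ≡ f′ (suc i)) → ∏₁ f n ≡ ∏₁ f′ n
∏₁-cong {zero}  eq = refl
∏₁-cong {suc n} eq = cong₂ _*_ (∏₁-cong (λ i i<n → eq i (ℕₚ.m<n⇒m<1+n i<n))) (eq n ℕₚ.≤-refl)

Σ₁-mono : (∀ i → i ℕ.< n → f (suc i) ≤ f′ (suc i)) → Σ₁ f n ≤ Σ₁ f′ n
Σ₁-mono {zero}  le = ≤-refl
Σ₁-mono {suc n} le = +-mono-≤ (Σ₁-mono (λ i i<n → le i (ℕₚ.m<n⇒m<1+n i<n))) (le n ℕₚ.≤-refl)

Σ₁-grows : (∀ i → 0ℚ ≤ f i) → m ℕ.≤ n → Σ₁ f m ≤ Σ₁ f n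
Σ₁-grows {f = f} f≥0 m≤n = go (ℕₚ.≤⇒≤′ m≤n)
  where
  go : m ℕ.≤′ n → Σ₁ f m ≤ Σ₁ f n
  go ℕ.≤′-refl                   = ≤-refl
  go (ℕ.≤′-step {n = n} m≤′n) = ≤-trans (go m≤′n) (0≤⇒≤ (f≥0 (suc n)) refl)

Σ₁-+ : ∀ f f′ n → Σ₁ (λ i → f i + f′ i) n ≡ Σ₁ f n + Σ₁ f′ n
Σ₁-+ f f′ zero    = refl
Σ₁-+ f f′ (suc n) = trans (cong (_+ (f (suc n) + f′ (suc n))) (Σ₁-+ f f′ n))
  (solve 4 (λ a b c d → (a :+ b) :+ (c :+ d) := (a :+ c) :+ (b :+ d)) refl
    (Σ₁ f n) (Σ₁ f′ n) (f (suc n)) (f′ (suc n)))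

Σ₁-* : ∀ c f n → Σ₁ (λ i → c * f i) n ≡ c * Σ₁ f n
Σ₁-* c f zero    = sym (*-zeroʳ c)
Σ₁-* c f (suc n) = trans (cong (_+ c * f (suc n)) (Σ₁-* c f n)) (sym (*-distribˡ-+ c (Σ₁ f n) (f (suc n))))

Σ₁-∸ : ∀ f f′ n → Σ₁ (λ i → f i - f′ i) n ≡ Σ₁ f n - Σ₁ f′ n
Σ₁-∸ f f′ zero    = refl
Σ₁-∸ f f′ (suc n) = trans (cong (_+ (f (suc n) - f′ (suc n))) (Σ₁-∸ f f′ n))
  (solve 4 (λ a b c d → (a :- b) :+ (c :- d) := (a :+ c) :- (b :+ d)) refl
    (Σ₁ f n) (Σ₁ f′ n) (f (suc n)) (f′ (suc n)))

Σ₁-1 : ∀ n → Σ₁ (λ _ → 1ℚ) n ≡ ι n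
Σ₁-1 zero    = sym ι-0
Σ₁-1 (suc n) = trans (cong (_+ 1ℚ) (Σ₁-1 n)) (sym (ι-suc n))

Σ₁-swap : ∀ (F : ℕ → ℕ → ℚ) m n →
          Σ₁ (λ i → Σ₁ (F i) n) m ≡ Σ₁ (λ j → Σ₁ (λ i → F i j) m) n
Σ₁-swap F zero    n = sym (zeros n)
  where
  zeros : ∀ n → Σ₁ (λ _ → 0ℚ) n ≡ 0ℚ
  zeros zero    = refl
  zeros (suc n) = cong (_+ 0ℚ) (zeros n)
Σ₁-swap F (suc m) n = trans (cong (_+ Σ₁ (F (suc m)) n) (Σ₁-swap F m n))
  (sym (Σ₁-+ (λ j → Σ₁ (λ i → F i j) m) (F (suc m)) n))

∏₁-complement-bounds : (α : ℕ → ℚ) → (∀ q → 0ℚ ≤ α q) → (∀ q → α q ≤ 1ℚ) →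
                       ∀ n → 0ℚ ≤ ∏₁ (λ q → 1ℚ - α q) n × ∏₁ (λ q → 1ℚ - α q) n ≤ 1ℚ
∏₁-complement-bounds α α≥0 α≤1 zero    = 0≤1 , ≤-refl
∏₁-complement-bounds α α≥0 α≤1 (suc n) = let P≥0 , P≤1 = ∏₁-complement-bounds α α≥0 α≤1 n in
  *-0≤ P≥0 (p≤q⇒0≤q-p (α≤1 (suc n))) ,
  0≤⇒≤ (+-0≤ (p≤q⇒0≤q-p P≤1) (*-0≤ P≥0 (α≥0 (suc n))))
    (solve 2 (λ P a → con 1ℚ := P :* (con 1ℚ :- a) :+ ((con 1ℚ :- P) :+ P :* a)) refl
      (∏₁ (λ q → 1ℚ - α q) n) (α (suc n)))

∏₁-complement-shrinks : (α : ℕ → ℚ) → (∀ q → 0ℚ ≤ α q) → (∀ q → α q ≤ 1ℚ) →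
                        m ℕ.≤ n → ∏₁ (λ q → 1ℚ - α q) n ≤ ∏₁ (λ q → 1ℚ - α q) m
∏₁-complement-shrinks α α≥0 α≤1 m≤n = go (ℕₚ.≤⇒≤′ m≤n)
  where
  go : m ℕ.≤′ n → ∏₁ (λ q → 1ℚ - α q) n ≤ ∏₁ (λ q → 1ℚ - α q) m
  go ℕ.≤′-refl                 = ≤-refl
  go (ℕ.≤′-step {n = n} m≤′n) = ≤-trans
    (0≤⇒≤ (*-0≤ (proj₁ (∏₁-complement-bounds α α≥0 α≤1 n)) (α≥0 (suc n)))
      (solve 2 (λ P a → P := P :* (con 1ℚ :- a) :+ P :* a) refl
        (∏₁ (λ q → 1ℚ - α q) n) (α (suc n))))
    (go m≤′n)

module _ (α β : ℕ → ℚ) (α≥0 : ∀ q → 0ℚ ≤ α q) (α≤β : ∀ q → α q ≤ β q) (β≤1 : ∀ q → β q ≤ 1ℚ) where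

  private
    P R S : ℕ → ℚ
    P = ∏₁ (λ q → 1ℚ - α q)
    R = ∏₁ (λ q → 1ℚ - β q)
    S = Σ₁ (λ q → β q - α q)

    R≥0 : ∀ n → 0ℚ ≤ R n
    R≥0 n = proj₁ (∏₁-complement-bounds β (λ q → ≤-trans (α≥0 q) (α≤β q)) β≤1 n)

    R≤1 : ∀ n → R n ≤ 1ℚ
    R≤1 n = proj₂ (∏₁-complement-bounds β (λ q → ≤-trans (α≥0 q) (α≤β q)) β≤1 n)

    b-a≥0 : ∀ q → 0ℚ ≤ β q - α q
    b-a≥0 q = p≤q⇒0≤q-p (α≤β q)

  -- The induction step rests on a certificate: the two sides differ by (P - R (1 + S)) (1 - a) + R
  -- (b - a) (S + b), all of whose factors are nonnegative. Most polynomial inequalities below are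
  -- settled in this way by `0≤⇒≤` and `solve`.
  ∏₁-complement-gap : ∀ n → R n * (1ℚ + S n) ≤ P n
  ∏₁-complement-gap zero    = ≤-refl
  ∏₁-complement-gap (suc n) = 0≤⇒≤
    (+-0≤ (*-0≤ (p≤q⇒0≤q-p (∏₁-complement-gap n)) (p≤q⇒0≤q-p (≤-trans (α≤β (suc n)) (β≤1 (suc n)))))
          (*-0≤ (R≥0 n) (*-0≤ (b-a≥0 (suc n)) (+-0≤ (Σ₁-grows b-a≥0 (ℕ.z≤n {n})) (≤-trans (α≥0 (suc n)) (α≤β (suc n)))))))
    (solve 5 (λ P R S a b → P :* (con 1ℚ :- a) :=
        (R :* (con 1ℚ :- b)) :* (con 1ℚ :+ (S :+ (b :- a))) :+
        ((P :- R :* (con 1ℚ :+ S)) :* (con 1ℚ :- a) :+ R :* ((b :- a) :* (S :+ b)))) refl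
      (P n) (R n) (S n) (α (suc n)) (β (suc n)))

  ∏₁-complement-antitone : ∀ n → R n ≤ P n
  ∏₁-complement-antitone n = ≤-trans
    (0≤⇒≤ (*-0≤ (R≥0 n) (Σ₁-grows b-a≥0 (ℕ.z≤n {n})))
      (solve 2 (λ R S → R :* (con 1ℚ :+ S) := R :+ R :* S) refl (R n) (S n)))
    (∏₁-complement-gap n)

  -- All products lie between 0 and 1, so exchanging one factor moves the whole by at most b - a.
  -- For the indicators of a single integer this is the union bound: a removed integer is hit by a
  -- new pair.
  ∏₁-complement-lipschitz : ∀ n → P n - R n ≤ S n
  ∏₁-complement-lipschitz zero    = ≤-refl
  ∏₁-complement-lipschitz (suc n) = 0≤⇒≤
    (+-0≤ (p≤q⇒0≤q-p (∏₁-complement-lipschitz n))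
      (+-0≤ (*-0≤ (p≤q⇒0≤q-p (∏₁-complement-antitone n)) (α≥0 (suc n)))
            (*-0≤ (p≤q⇒0≤q-p (R≤1 n)) (b-a≥0 (suc n)))))
    (solve 5 (λ P R S a b → S :+ (b :- a) :=
        (P :* (con 1ℚ :- a) :- R :* (con 1ℚ :- b)) :+
        ((S :- (P :- R)) :+ ((P :- R) :* a :+ (con 1ℚ :- R) :* (b :- a)))) refl
      (P n) (R n) (S n) (α (suc n)) (β (suc n)))

-- Weights, masses and divisibility indicators

record Weight (w : ℕ → ℚ) : Set where
  field
    decreasing  : ∀ i → w (suc i) ≤ w i
    nonnegative : ∀ i → 0ℚ ≤ w i
    start≤1     : w 0 ≤ 1ℚ

-- The difference `w i - w (suc i)` stands for exponent exactly i, as a density or as an indicator,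
-- and c selects among the exponents from 1 on.
mass : (c w : ℕ → ℚ) → ℕ → ℚ
mass c w = Σ₁ (λ i → c i * (w i - w (suc i)))

mass-grows : ∀ {c w} → (∀ i → 0ℚ ≤ c i) → Weight w → m ℕ.≤ n → mass c w m ≤ mass c w n
mass-grows c≥0 W = Σ₁-grows (λ i → *-0≤ (c≥0 i) (p≤q⇒0≤q-p (Weight.decreasing W i)))

mass≥0 : ∀ {c w} → (∀ i → 0ℚ ≤ c i) → Weight w → ∀ k → 0ℚ ≤ mass c w k
mass≥0 c≥0 W k = mass-grows c≥0 W (ℕ.z≤n {k})

mass≤1 : ∀ {c w} → (∀ i → c i ≤ 1ℚ) → Weight w → ∀ k → mass c w k ≤ 1ℚ
mass≤1 {c} {w} c≤1 W k = begin
  mass c w k            ≤⟨ telescope k ⟩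
  w 1 - w (suc k)
    ≤⟨ 0≤⇒≤ (nonnegative (suc k)) (solve 2 (λ a b → a := (a :- b) :+ b) refl (w 1) (w (suc k))) ⟩
  w 1                   ≤⟨ decreasing 0 ⟩
  w 0                   ≤⟨ start≤1 ⟩
  1ℚ                    ∎
  where
  open Weight W
  open ≤-Reasoning
  telescope : ∀ k → mass c w k ≤ w 1 - w (suc k)
  telescope zero    = ≤-reflexive (sym (+-inverseʳ (w 1)))
  telescope (suc k) = 0≤⇒≤
    (+-0≤ (p≤q⇒0≤q-p (telescope k)) (*-0≤ (p≤q⇒0≤q-p (c≤1 (suc k))) (p≤q⇒0≤q-p (decreasing (suc k)))))
    (solve 5 (λ M c u v v′ → u :- v′ := (M :+ c :* (v :- v′)) :+ (((u :- v) :- M) :+ (con 1ℚ :- c) :* (v :- v′)))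
      refl (mass c w k) (c (suc k)) (w 1) (w (suc k)) (w (suc (suc k))))

mass-zero : ∀ {c} w → (∀ i → c i ≡ 0ℚ) → ∀ k → mass c w k ≡ 0ℚ
mass-zero w c≡0 zero    = refl
mass-zero w c≡0 (suc k) = trans (cong₂ _+_ (mass-zero w c≡0 k) (cong (_* (w (suc k) - w (suc (suc k)))) (c≡0 (suc k))))
  (trans (+-identityˡ _) (*-zeroˡ (w (suc k) - w (suc (suc k)))))

dvd : ℕ → ℕ → ℚ
dvd q m with q ∣? m
... | yes _ = 1ℚ
... | no  _ = 0ℚ

dvd-yes : ∀ {q m} → q ∣ m → dvd q m ≡ 1ℚ
dvd-yes {q} {m} q∣m with q ∣? m
... | yes _   = refl
... | no  q∤m = contradiction q∣m q∤m

dvd-no : ∀ {q m} → ¬ q ∣ m → dvd q m ≡ 0ℚ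
dvd-no {q} {m} q∤m with q ∣? m
... | yes q∣m = contradiction q∣m q∤m
... | no  _   = refl

dvd-cong : ∀ {q m q′ m′} → (q ∣ m → q′ ∣ m′) → (q′ ∣ m′ → q ∣ m) → dvd q m ≡ dvd q′ m′
dvd-cong {q} {m} to from with q ∣? m
... | yes q∣m = sym (dvd-yes (to q∣m))
... | no  q∤m = sym (dvd-no (λ d → q∤m (from d)))

dvd≥0 : ∀ q m → 0ℚ ≤ dvd q m
dvd≥0 q m with q ∣? m
... | yes _ = 0≤1
... | no  _ = ≤-refl

dvd≤1 : ∀ q m → dvd q m ≤ 1ℚ
dvd≤1 q m with q ∣? m
... | yes _ = ≤-refl
... | no  _ = 0≤1

dvd-antitone : ∀ {q q′} m → q ∣ q′ → dvd q′ m ≤ dvd q m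
dvd-antitone {q} {q′} m q∣q′ with q′ ∣? m
... | yes q′∣m = ≤-reflexive (sym (dvd-yes (∣-trans q∣q′ q′∣m)))
... | no  _    = dvd≥0 q m

-- Writing the upper end as r + t · q lets the recursion follow Euclidean division: r steps discard
-- non-multiples, then the multiple at r = 0 is peeled off and the remainder restarts at q - 1.
Σ₁-multiples : ∀ (χ : ℕ → ℚ) q t r → r ℕ.< q →
               Σ₁ (λ m → χ m * dvd q m) (r ℕ.+ t ℕ.* q) ≡ Σ₁ (λ m → χ (m ℕ.* q)) t
Σ₁-multiples χ q       zero    zero    r<q = refl
Σ₁-multiples χ (suc q) (suc t) zero    r<q = cong₂ _+_
  (Σ₁-multiples χ (suc q) t q (ℕₚ.n<1+n q))
  (trans (cong (χ (suc t ℕ.* suc q) *_) (dvd-yes {suc q} {suc t ℕ.* suc q} (n∣m*n (suc t))))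
    (*-identityʳ (χ (suc t ℕ.* suc q))))
Σ₁-multiples χ q       t       (suc r) r<q = trans
  (cong₂ _+_ (Σ₁-multiples χ q t r (ℕₚ.<-trans (ℕₚ.n<1+n r) r<q))
    (trans (cong (χ M *_) (dvd-no {q} {M} λ q∣ → >⇒∤ r<q
        (∣m+n∣m⇒∣n (subst (q ∣_) (ℕₚ.+-comm (suc r) (t ℕ.* q)) q∣) (n∣m*n t))))
      (*-zeroʳ (χ M))))
  (+-identityʳ _)
  where M = suc (r ℕ.+ t ℕ.* q)

-- The error is uniform in N, which survives linear combinations and restriction to multiples. Its
-- dependence on χ is not tracked, so it serves only for a sieve of fixed level.
record HasMean (χ : ℕ → ℚ) (δ : ℚ) : Set where
  constructor hasMean
  field
    error : ℚ
    bound : ∀ N → ∣ Σ₁ χ N - δ * ι N ∣ ≤ error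

mean-1 : HasMean (λ _ → 1ℚ) 1ℚ
mean-1 = hasMean 0ℚ λ N → ≤-reflexive (trans
  (cong (λ s → ∣ s - 1ℚ * ι N ∣) (Σ₁-1 N))
  (cong ∣_∣ (solve 1 (λ n → n :- con 1ℚ :* n := con 0ℚ) refl (ι N))))

mean-cong : ∀ {χ χ′ δ δ′} → (∀ m → χ m ≡ χ′ m) → δ ≡ δ′ → HasMean χ δ → HasMean χ′ δ′
mean-cong {δ = δ} eq refl (hasMean B bound) = hasMean B λ N →
  subst (λ s → ∣ s - δ * ι N ∣ ≤ B) (Σ₁-cong {N} (λ i _ → eq (suc i))) (bound N)

mean-* : ∀ {χ δ} c → HasMean χ δ → HasMean (λ m → c * χ m) (c * δ)
mean-* {χ} {δ} c (hasMean B bound) = hasMean (∣ c ∣ * B) λ N → begin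
  ∣ Σ₁ (λ m → c * χ m) N - c * δ * ι N ∣ ≡⟨ cong (λ s → ∣ s - c * δ * ι N ∣) (Σ₁-* c χ N) ⟩
  ∣ c * Σ₁ χ N - c * δ * ι N ∣
    ≡⟨ cong ∣_∣ (solve 4 (λ c s d n → c :* s :- c :* d :* n := c :* (s :- d :* n)) refl c (Σ₁ χ N) δ (ι N)) ⟩
  ∣ c * (Σ₁ χ N - δ * ι N) ∣             ≡⟨ ∣p*q∣≡∣p∣*∣q∣ c (Σ₁ χ N - δ * ι N) ⟩
  ∣ c ∣ * ∣ Σ₁ χ N - δ * ι N ∣           ≤⟨ *-monoˡ-≤-0≤ (0≤∣p∣ c) (bound N) ⟩
  ∣ c ∣ * B                              ∎
  where open ≤-Reasoning

mean-+ : ∀ {χ χ′ δ δ′} → HasMean χ δ → HasMean χ′ δ′ → HasMean (λ m → χ m + χ′ m) (δ + δ′)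
mean-+ {χ} {χ′} {δ} {δ′} (hasMean B bound) (hasMean B′ bound′) = hasMean (B + B′) λ N → begin
  ∣ Σ₁ (λ m → χ m + χ′ m) N - (δ + δ′) * ι N ∣          ≡⟨ cong (λ s → ∣ s - (δ + δ′) * ι N ∣) (Σ₁-+ χ χ′ N) ⟩
  ∣ Σ₁ χ N + Σ₁ χ′ N - (δ + δ′) * ι N ∣
    ≡⟨ cong ∣_∣ (solve 5 (λ s s′ d d′ n → s :+ s′ :- (d :+ d′) :* n := (s :- d :* n) :+ (s′ :- d′ :* n)) refl
         (Σ₁ χ N) (Σ₁ χ′ N) δ δ′ (ι N)) ⟩
  ∣ (Σ₁ χ N - δ * ι N) + (Σ₁ χ′ N - δ′ * ι N) ∣
    ≤⟨ ∣p+q∣≤∣p∣+∣q∣ (Σ₁ χ N - δ * ι N) (Σ₁ χ′ N - δ′ * ι N) ⟩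
  ∣ Σ₁ χ N - δ * ι N ∣ + ∣ Σ₁ χ′ N - δ′ * ι N ∣         ≤⟨ +-mono-≤ (bound N) (bound′ N) ⟩
  B + B′                                                ∎
  where open ≤-Reasoning

mean-∸ : ∀ {χ χ′ δ δ′} → HasMean χ δ → HasMean χ′ δ′ → HasMean (λ m → χ m - χ′ m) (δ - δ′)
mean-∸ {χ} {χ′} {δ} {δ′} M M′ = mean-cong
  (λ m → minus (χ m) (χ′ m)) (minus δ δ′) (mean-+ M (mean-* (- 1ℚ) M′))
  where
  minus : ∀ p q → p + (- 1ℚ) * q ≡ p - q
  minus = solve 2 (λ p q → p :+ con (- 1ℚ) :* q := p :- q) refl

-- Substituting m = j q turns the sum into one of χ over j ≤ N / q, as χ ignores the factor q.
-- Replacing the floor of N / q by N / q costs at most ∣ δ ∣.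
mean-dvd : ∀ {χ δ} q .{{_ : NonZero q}} → (∀ m → χ (m ℕ.* q) ≡ χ m) →
           HasMean χ δ → HasMean (λ m → χ m * dvd q m) (δ * recip (ι q))
mean-dvd {χ} {δ} q invariant (hasMean B bound) = hasMean (B + ∣ δ ∣) λ N →
  let
    t = N ℕ./ q
    r = N ℕ.% q
    ρ = recip (ι q)
    qρ≡1 = *-recip (ι>0 q)
    ρ≥0 = <⇒≤ (recip>0 (ι>0 q))
    N≡ = m≡m%n+[m/n]*n N q
  in begin
  ∣ Σ₁ (λ m → χ m * dvd q m) N - δ * ρ * ι N ∣
    ≡⟨ cong (λ k → ∣ Σ₁ (λ m → χ m * dvd q m) k - δ * ρ * ι k ∣) N≡ ⟩
  ∣ Σ₁ (λ m → χ m * dvd q m) (r ℕ.+ t ℕ.* q) - δ * ρ * ι (r ℕ.+ t ℕ.* q) ∣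
    ≡⟨ cong₂ (λ s k → ∣ s - δ * ρ * k ∣)
         (trans (Σ₁-multiples χ q t r (m%n<n N q)) (Σ₁-cong {t} (λ i _ → invariant (suc i))))
         (trans (ι-+ r (t ℕ.* q)) (cong (ι r +_) (ι-* t q))) ⟩
  ∣ Σ₁ χ t - δ * ρ * (ι r + ι t * ι q) ∣
    ≡⟨ cong ∣_∣ (solve 6 (λ s d p r t q → s :- d :* p :* (r :+ t :* q) := (s :- d :* (t :* (q :* p))) :+ (:- d) :* (p :* r)) refl
         (Σ₁ χ t) δ ρ (ι r) (ι t) (ι q)) ⟩
  ∣ (Σ₁ χ t - δ * (ι t * (ι q * ρ))) + (- δ) * (ρ * ι r) ∣
    ≡⟨ cong (λ z → ∣ (Σ₁ χ t - δ * z) + (- δ) * (ρ * ι r) ∣) (trans (cong (ι t *_) qρ≡1) (*-identityʳ (ι t))) ⟩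
  ∣ (Σ₁ χ t - δ * ι t) + (- δ) * (ρ * ι r) ∣
    ≤⟨ ∣p+q∣≤∣p∣+∣q∣ (Σ₁ χ t - δ * ι t) ((- δ) * (ρ * ι r)) ⟩
  ∣ Σ₁ χ t - δ * ι t ∣ + ∣ (- δ) * (ρ * ι r) ∣
    ≡⟨ cong (∣ Σ₁ χ t - δ * ι t ∣ +_) (trans (∣p*q∣≡∣p∣*∣q∣ (- δ) (ρ * ι r)) (cong₂ _*_ (∣-p∣≡∣p∣ δ) (0≤p⇒∣p∣≡p (*-0≤ ρ≥0 (ι≥0 r))))) ⟩
  ∣ Σ₁ χ t - δ * ι t ∣ + ∣ δ ∣ * (ρ * ι r)
    ≤⟨ +-mono-≤ (bound t) (*-monoˡ-≤-0≤ (0≤∣p∣ δ) (≤-trans (*-monoˡ-≤-0≤ ρ≥0 (ι-mono (ℕₚ.<⇒≤ (m%n<n N q))))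
         (≤-reflexive (trans (*-comm ρ (ι q)) qρ≡1)))) ⟩
  B + ∣ δ ∣ * 1ℚ
    ≡⟨ cong (B +_) (*-identityʳ ∣ δ ∣) ⟩
  B + ∣ δ ∣ ∎
  where open ≤-Reasoning

-- One-sided and free of an error term, so it can be added over arbitrarily many primes and
-- exponents.
Σ₁-dvd≤ : ∀ q .{{_ : NonZero q}} N → Σ₁ (dvd q) N ≤ ι N * recip (ι q)
Σ₁-dvd≤ q N = begin
  Σ₁ (dvd q) N                               ≡⟨ Σ₁-cong {N} (λ i _ → sym (*-identityˡ (dvd q (suc i)))) ⟩
  Σ₁ (λ m → 1ℚ * dvd q m) N                  ≡⟨ cong (Σ₁ (λ m → 1ℚ * dvd q m)) N≡ ⟩
  Σ₁ (λ m → 1ℚ * dvd q m) (r ℕ.+ t ℕ.* q)    ≡⟨ Σ₁-multiples (λ _ → 1ℚ) q t r (m%n<n N q) ⟩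
  Σ₁ (λ _ → 1ℚ) t                            ≡⟨ Σ₁-1 t ⟩
  ι t                                        ≡⟨ *-identityʳ (ι t) ⟨
  ι t * 1ℚ                                   ≡⟨ cong (ι t *_) (*-recip (ι>0 q)) ⟨
  ι t * (ι q * ρ)                            ≡⟨ *-assoc (ι t) (ι q) ρ ⟨
  ι t * ι q * ρ                              ≡⟨ cong (_* ρ) (ι-* t q) ⟨
  ι (t ℕ.* q) * ρ
    ≤⟨ *-monoʳ-≤-0≤ (<⇒≤ (recip>0 (ι>0 q))) (ι-mono (ℕₚ.m≤n+m (t ℕ.* q) r)) ⟩
  ι (r ℕ.+ t ℕ.* q) * ρ                      ≡⟨ cong (λ k → ι k * ρ) N≡ ⟨
  ι N * ρ                                    ∎
  where
  open ≤-Reasoning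
  t = N ℕ./ q
  r = N ℕ.% q
  ρ = recip (ι q)
  N≡ = m≡m%n+[m/n]*n N q

-- Divisibility by prime powers

recip-unique : ∀ {p q} → 0ℚ < p → p * q ≡ 1ℚ → q ≡ recip p
recip-unique {p} {q} p>0 pq≡1 = begin
  q                     ≡⟨ *-identityˡ q ⟨
  1ℚ * q                ≡⟨ cong (_* q) (*-recip p>0) ⟨
  p * recip p * q       ≡⟨ solve 3 (λ p r q → p :* r :* q := r :* (p :* q)) refl p (recip p) q ⟩
  recip p * (p * q)     ≡⟨ cong (recip p *_) pq≡1 ⟩
  recip p * 1ℚ          ≡⟨ *-identityʳ (recip p) ⟩
  recip p               ∎
  where open ≡-Reasoning

recip-* : ∀ {p q} → 0ℚ < p → 0ℚ < q → recip (p * q) ≡ recip p * recip q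
recip-* {p} {q} p>0 q>0 = sym (recip-unique (pos* p>0 q>0) (trans
  (solve 4 (λ p q r s → (p :* q) :* (r :* s) := (p :* r) :* (q :* s)) refl p q (recip p) (recip q))
  (cong₂ _*_ (*-recip p>0) (*-recip q>0))))

prime∣^⇒∣ : ∀ {p q} i → Prime p → p ∣ q ^ i → p ∣ q
prime∣^⇒∣ zero    pr p∣1 = contradiction (subst Prime (∣1⇒≡1 p∣1) pr) ¬prime[1]
prime∣^⇒∣ {q = q} (suc i) pr p∣ = [ id , prime∣^⇒∣ i pr ]′ (euclidsLemma q (q ^ i) pr p∣)

-- Only p is assumed prime, since in `sieve-invariant` q runs over all positive numbers below p.
^∣*⇒^∣ : ∀ {p q} i → Prime p → ¬ p ∣ q → q ^ i ∣ m ℕ.* p → q ^ i ∣ m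
^∣*⇒^∣ {m} {p} {q} i pr p∤q q^i∣ = coprime-divisor coprime (subst (q ^ i ∣_) (ℕₚ.*-comm m p) q^i∣)
  where
  coprime : Coprime (q ^ i) p
  coprime (d∣q^i , d∣p) = [ id , (λ d≡p → contradiction (prime∣^⇒∣ i pr (subst (_∣ q ^ i) d≡p d∣q^i)) p∤q) ]′
    (prime⇒irreducible pr d∣p)

-- The weights 1/qⁱ turn mass into a density, the weights [ qⁱ ∣ m ] into the
-- indicator of that density's set.
recipPow : ℕ → ℕ → ℚ
recipPow q i = recip (ι (q ^ i))

dvdPow : ℕ → ℕ → ℕ → ℚ
dvdPow m q i = dvd (q ^ i) m

recip-zero : recip (ι 0) ≡ 0ℚ
recip-zero = cong recip ι-0

recip-ι≥0 : ∀ n → 0ℚ ≤ recip (ι n)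
recip-ι≥0 zero    = ≤-reflexive (sym recip-zero)
recip-ι≥0 (suc n) = <⇒≤ (recip>0 (ι>0 (suc n)))

recipPow-suc : ∀ q .{{_ : NonZero q}} i → recipPow q i ≡ ι q * recipPow q (suc i)
recipPow-suc q i = begin
  recip (ι (q ^ i))                             ≡⟨ *-identityˡ _ ⟨
  1ℚ * recip (ι (q ^ i))                        ≡⟨ cong (_* recip (ι (q ^ i))) (*-recip (ι>0 q)) ⟨
  ι q * recip (ι q) * recip (ι (q ^ i))         ≡⟨ *-assoc (ι q) (recip (ι q)) (recip (ι (q ^ i))) ⟩
  ι q * (recip (ι q) * recip (ι (q ^ i)))
    ≡⟨ cong (ι q *_) (recip-* (ι>0 q) (ι>0 (q ^ i) {{ℕₚ.m^n≢0 q i}})) ⟨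
  ι q * recip (ι q * ι (q ^ i))                 ≡⟨ cong (λ t → ι q * recip t) (ι-* q (q ^ i)) ⟨
  ι q * recip (ι (q ^ suc i))                   ∎
  where open ≡-Reasoning

recipPow-weight : ∀ q → Weight (recipPow q)
recipPow-weight q = record
  { decreasing  = decreasing q
  ; nonnegative = λ i → recip-ι≥0 (q ^ i)
  ; start≤1     = ≤-reflexive (cong recip ι-1)
  }
  where
  decreasing : ∀ q i → recipPow q (suc i) ≤ recipPow q i
  -- The value 0 of `recip` at 0 makes the powers of 0 a weight as well, so q may be any number.
  decreasing zero        i = subst (_≤ recipPow 0 i) (sym recip-zero) (recip-ι≥0 (0 ^ i))
  decreasing q@(suc q-1) i = 0≤⇒≤ (*-0≤ (ι≥0 q-1) (recip-ι≥0 (q ^ suc i))) (begin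
    recipPow q i                                        ≡⟨ recipPow-suc q i ⟩
    ι q * recipPow q (suc i)                            ≡⟨ cong (_* recipPow q (suc i)) (ι-suc q-1) ⟩
    (ι q-1 + 1ℚ) * recipPow q (suc i)
      ≡⟨ solve 2 (λ a r → (a :+ con 1ℚ) :* r := r :+ a :* r) refl (ι q-1) (recipPow q (suc i)) ⟩
    recipPow q (suc i) + ι q-1 * recipPow q (suc i)     ∎)
    where open ≡-Reasoning

-- The gap is (1 - 1/q) / qⁱ, and 1 - 1/q is at least 1/2 for q ≥ 2.
recipPow≤2*gap : ∀ q .{{_ : ℕ.NonTrivial q}} i → recipPow q i ≤ ι 2 * (recipPow q i - recipPow q (suc i))
recipPow≤2*gap (suc (suc q)) i = 0≤⇒≤ (*-0≤ (ι≥0 q) (recip-ι≥0 (k ^ suc i))) (begin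
  ι 2 * (w - w′)
    ≡⟨ cong₂ (λ t u → t * (u - w′)) (ι-+ 1 1) (recipPow-suc k i) ⟩
  (ι 1 + ι 1) * (ι k * w′ - w′)
    ≡⟨ cong₂ (λ t u → (u + u) * (t * w′ - w′)) (trans (ι-suc (suc q)) (cong (_+ 1ℚ) (ι-suc q))) ι-1 ⟩
  (1ℚ + 1ℚ) * ((ι q + 1ℚ + 1ℚ) * w′ - w′)
    ≡⟨ solve 2 (λ q w → (con 1ℚ :+ con 1ℚ) :* ((q :+ con 1ℚ :+ con 1ℚ) :* w :- w) := (q :+ con 1ℚ :+ con 1ℚ) :* w :+ q :* w) refl (ι q) w′ ⟩
  (ι q + 1ℚ + 1ℚ) * w′ + ι q * w′
    ≡⟨ cong (λ t → t * w′ + ι q * w′) (trans (ι-suc (suc q)) (cong (_+ 1ℚ) (ι-suc q))) ⟨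
  ι k * w′ + ι q * w′                                 ≡⟨ cong (_+ ι q * w′) (recipPow-suc k i) ⟨
  w + ι q * w′                                        ∎)
  where
  open ≡-Reasoning
  k = suc (suc q)
  w  = recipPow k i
  w′ = recipPow k (suc i)

dvdPow-weight : ∀ m q → Weight (dvdPow m q)
dvdPow-weight m q = record
  { decreasing  = λ i → dvd-antitone m (n∣m*n q)
  ; nonnegative = λ i → dvd≥0 (q ^ i) m
  ; start≤1     = dvd≤1 (q ^ 0) m
  }

-- Exponents of q are independent of a χ that is blind to factors q: the invariance passes to every
-- power of q, and `mean-dvd` applies to each exponent separately.
mean-mass : ∀ {χ δ} q .{{_ : NonZero q}} → (∀ m → χ (m ℕ.* q) ≡ χ m) → HasMean χ δ →
            ∀ c k → HasMean (λ m → χ m * mass c (dvdPow m q) k) (δ * mass c (recipPow q) k)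
mean-mass {χ} {δ} q invariant M c zero    = mean-cong
  (λ m → trans (*-zeroˡ (χ m)) (sym (*-zeroʳ (χ m)))) (trans (*-zeroˡ δ) (sym (*-zeroʳ δ))) (mean-* 0ℚ M)
mean-mass {χ} {δ} q invariant M c (suc k) = mean-cong
  (λ m → expand (χ m) (mass c (dvdPow m q) k) (c (suc k)) (dvdPow m q (suc k)) (dvdPow m q (suc (suc k))))
  (expand δ (mass c (recipPow q) k) (c (suc k)) (recipPow q (suc k)) (recipPow q (suc (suc k))))
  (mean-+ (mean-mass q invariant M c k) (mean-* (c (suc k)) (mean-∸ (level (suc k)) (level (suc (suc k))))))
  where
  expand : ∀ x M c u v → x * M + c * (x * u - x * v) ≡ x * (M + c * (u - v))
  expand = solve 5 (λ x M c u v → x :* M :+ c :* (x :* u :- x :* v) := x :* (M :+ c :* (u :- v))) refl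
  invariant^ : ∀ i m → χ (m ℕ.* q ^ i) ≡ χ m
  invariant^ zero    m = cong χ (ℕₚ.*-identityʳ m)
  invariant^ (suc i) m = trans (cong χ (sym (ℕₚ.*-assoc m q (q ^ i)))) (trans (invariant^ i (m ℕ.* q)) (invariant m))
  level : ∀ i → HasMean (λ m → χ m * dvdPow m q i) (δ * recipPow q i)
  level i = mean-dvd (q ^ i) {{ℕₚ.m^n≢0 q i}} (invariant^ i) M

Σ₁-mass-gap : ∀ {c} q .{{_ : ℕ.NonTrivial q}} → (∀ i → 0ℚ ≤ c i) → ∀ N {k k′} → k ℕ.≤ k′ →
              Σ₁ (λ m → mass c (dvdPow m q) k′ - mass c (dvdPow m q) k) N ≤
              ι N * (ι 2 * (mass c (recipPow q) k′ - mass c (recipPow q) k))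
Σ₁-mass-gap {c} q c≥0 N {k} {k′} k≤k′ = 0≤⇒≤ (p≤q⇒0≤q-p (Σ₁-grows u≥0 k≤k′)) (begin-equality
  ι N * (ι 2 * (R k′ - R k))
    ≡⟨ solve 6 (λ n t r r′ d d′ → n :* (t :* (r′ :- r)) := (d′ :- d) :+ ((n :* t :* r′ :- d′) :- (n :* t :* r :- d))) refl
         (ι N) (ι 2) (R k) (R k′) (D k) (D k′) ⟩
  (D k′ - D k) + ((ι N * ι 2 * R k′ - D k′) - (ι N * ι 2 * R k - D k))
    ≡⟨ cong₂ _+_ (Σ₁-∸ (λ m → mass c (dvdPow m q) k′) (λ m → mass c (dvdPow m q) k) N) (cong₂ _-_ (Σ₁-u k′) (Σ₁-u k)) ⟨
  Σ₁ (λ m → mass c (dvdPow m q) k′ - mass c (dvdPow m q) k) N + (Σ₁ u k′ - Σ₁ u k) ∎)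
  where
  open ≤-Reasoning
  R D u : ℕ → ℚ
  R = mass c (recipPow q)
  D k = Σ₁ (λ m → mass c (dvdPow m q) k) N
  -- The slack at exponent i: at most N / qⁱ integers have this exponent, and N / qⁱ is at most 2 N
  -- times the gap. As slacks are nonnegative, their partial sums increase from k to k′, which is
  -- the claim.
  u i = ι N * ι 2 * (c i * (recipPow q i - recipPow q (suc i))) -
        Σ₁ (λ m → c i * (dvdPow m q i - dvdPow m q (suc i))) N

  Σ₁-u : ∀ k → Σ₁ u k ≡ ι N * ι 2 * R k - D k
  Σ₁-u k = trans
    (Σ₁-∸ (λ i → ι N * ι 2 * (c i * (recipPow q i - recipPow q (suc i)))) (λ i → Σ₁ (λ m → c i * (dvdPow m q i - dvdPow m q (suc i))) N) k)
    (cong₂ _-_ (Σ₁-* (ι N * ι 2) (λ i → c i * (recipPow q i - recipPow q (suc i))) k)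
               (sym (Σ₁-swap (λ m i → c i * (dvdPow m q i - dvdPow m q (suc i))) N k)))

  u≥0 : ∀ i → 0ℚ ≤ u i
  u≥0 i = p≤q⇒0≤q-p (begin
    Σ₁ (λ m → c i * (dvdPow m q i - dvdPow m q (suc i))) N
      ≤⟨ Σ₁-mono {N} (λ m _ → *-monoˡ-≤-0≤ (c≥0 i) (0≤⇒≤ (dvd≥0 (q ^ suc i) (suc m))
           (solve 2 (λ a b → a := (a :- b) :+ b) refl (dvdPow (suc m) q i) (dvdPow (suc m) q (suc i))))) ⟩
    Σ₁ (λ m → c i * dvdPow m q i) N
      ≡⟨ Σ₁-* (c i) (dvd (q ^ i)) N ⟩
    c i * Σ₁ (dvd (q ^ i)) N
      ≤⟨ *-monoˡ-≤-0≤ (c≥0 i) (≤-trans (Σ₁-dvd≤ (q ^ i) {{ℕₚ.m^n≢0 q i {{ℕ.nonTrivial⇒nonZero q}}}} N)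
             (*-monoˡ-≤-0≤ (ι≥0 N) (recipPow≤2*gap q i))) ⟩
    c i * (ι N * (ι 2 * (recipPow q i - recipPow q (suc i))))
      ≡⟨ solve 4 (λ c n t g → c :* (n :* (t :* g)) := n :* t :* (c :* g)) refl (c i) (ι N) (ι 2) (recipPow q i - recipPow q (suc i)) ⟩
    ι N * ι 2 * (c i * (recipPow q i - recipPow q (suc i))) ∎)

-- The sieve

Eventually : (ℕ → Set) → Set
Eventually P = ∃[ N ] (∀ n → N ℕ.≤ n → P n)

eventually-× : ∀ {P P′ : ℕ → Set} → Eventually P → Eventually P′ → Eventually (λ n → P n × P′ n)
eventually-× (N , p) (N′ , p′) = N ℕ.⊔ N′ , λ n ≤n →
  p n (ℕₚ.m⊔n≤o⇒m≤o N N′ ≤n) , p′ n (ℕₚ.m⊔n≤o⇒n≤o N N′ ≤n)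

eventually-≤ι* : ∀ b {ε} → 0ℚ < ε → Eventually (λ n → b ≤ ι n * ε)
eventually-≤ι* b ε>0 = let k , b≤ = archimedean b ε>0 in
  k , λ n k≤n → ≤-trans b≤ (*-monoʳ-≤-0≤ (<⇒≤ ε>0) (ι-mono k≤n))

-- Level n of the sieve uses the primes q ≤ n, each with exponents up to n.
level : ℕ → ℕ → ℕ
level n q with q ℕₚ.≤? n
... | yes _ = n
... | no  _ = 0

level-≤ : ∀ {n q} → q ℕ.≤ n → level n q ≡ n
level-≤ {n} {q} q≤n with q ℕₚ.≤? n
... | yes _   = refl
... | no  q≰n = contradiction q≤n q≰n

level-> : ∀ {n q} → n ℕ.< q → level n q ≡ 0
level-> {n} {q} n<q with q ℕₚ.≤? n
... | yes q≤n = contradiction q≤n (ℕₚ.<⇒≱ n<q)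
... | no  _   = refl

level-mono : ∀ q → m ℕ.≤ n → level m q ℕ.≤ level n q
level-mono {m} {n} q m≤n with q ℕₚ.≤? m
... | yes q≤m = ℕₚ.≤-trans m≤n (ℕₚ.≤-reflexive (sym (level-≤ (ℕₚ.≤-trans q≤m m≤n))))
... | no  _   = ℕ.z≤n

-- Primality is encoded in the coefficients: at any other q the cover is 0 and the factor is 1, so
-- products and sums can run over consecutive q.
module Sieve (c : ℕ → ℕ → ℚ) (c≥0 : ∀ q i → 0ℚ ≤ c q i) (c≤1 : ∀ q i → c q i ≤ 1ℚ)
             (c-¬prime : ∀ {q} → ¬ Prime q → ∀ i → c q i ≡ 0ℚ) where

  -- Used once for the densities and once for each integer m, so every inequality here holds for
  -- densities and pointwise for indicators.
  module Family (w : ℕ → ℕ → ℚ) (W : ∀ q → Weight (w q)) where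

    cover : ℕ → ℕ → ℚ
    cover n q = mass (c q) (w q) (level n q)

    sieve : ℕ → ℕ → ℚ
    sieve n z = ∏₁ (λ q → 1ℚ - cover n q) z

    cover≥0 : ∀ n q → 0ℚ ≤ cover n q
    cover≥0 n q = mass≥0 (c≥0 q) (W q) (level n q)

    cover≤1 : ∀ n q → cover n q ≤ 1ℚ
    cover≤1 n q = mass≤1 (c≤1 q) (W q) (level n q)

    cover-mono : m ℕ.≤ n → ∀ q → cover m q ≤ cover n q
    cover-mono m≤n q = mass-grows (c≥0 q) (W q) (level-mono q m≤n)

    -- Numbers above n have level 0 and contribute the factor 1. This lets two levels be compared
    -- over a common range.
    sieve-beyond : ∀ {n z} → n ℕ.≤ z → sieve n z ≡ sieve n n
    sieve-beyond {n} n≤z = go (ℕₚ.≤⇒≤′ n≤z)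
      where
      go : ∀ {z} → n ℕ.≤′ z → sieve n z ≡ sieve n n
      go ℕ.≤′-refl                 = refl
      go (ℕ.≤′-step {n = z} n≤′z) = trans
        (cong (λ k → sieve n z * (1ℚ - mass (c (suc z)) (w (suc z)) k)) (level-> (ℕ.s≤s (ℕₚ.≤′⇒≤ n≤′z))))
        (trans (*-identityʳ (sieve n z)) (go n≤′z))

    sieve≥0 : ∀ n z → 0ℚ ≤ sieve n z
    sieve≥0 n z = proj₁ (∏₁-complement-bounds (cover n) (cover≥0 n) (cover≤1 n) z)

    sieve≤1 : ∀ n z → sieve n z ≤ 1ℚ
    sieve≤1 n z = proj₂ (∏₁-complement-bounds (cover n) (cover≥0 n) (cover≤1 n) z)

    sieve-antitone : m ℕ.≤ n → ∀ z → sieve n z ≤ sieve m z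
    sieve-antitone {m} {n} m≤n =
      ∏₁-complement-antitone (cover m) (cover n) (cover≥0 m) (cover-mono m≤n) (cover≤1 n)

    sieve-diagonal-antitone : m ℕ.≤ n → sieve n n ≤ sieve m m
    sieve-diagonal-antitone {m} {n} m≤n = ≤-trans (sieve-antitone m≤n n) (≤-reflexive (sieve-beyond m≤n))

    newCover : ℕ → ℕ → ℚ
    newCover m n = Σ₁ (λ q → cover n q - cover m q) n

    sieve-gap : m ℕ.≤ n → sieve n n * (1ℚ + newCover m n) ≤ sieve m m
    sieve-gap {m} {n} m≤n = ≤-trans
      (∏₁-complement-gap (cover m) (cover n) (cover≥0 m) (cover-mono m≤n) (cover≤1 n) n)
      (≤-reflexive (sieve-beyond m≤n))

    sieve-lipschitz : m ℕ.≤ n → sieve m m - sieve n n ≤ newCover m n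
    sieve-lipschitz {m} {n} m≤n = ≤-trans
      (≤-reflexive (cong (_- sieve n n) (sym (sieve-beyond m≤n))))
      (∏₁-complement-lipschitz (cover m) (cover n) (cover≥0 m) (cover-mono m≤n) (cover≤1 n) n)

  module D = Family recipPow recipPow-weight
  module I m = Family (dvdPow m) (dvdPow-weight m)

  density : ℕ → ℚ
  density n = D.sieve n n

  indicator : ℕ → ℕ → ℚ
  indicator n m = I.sieve m n n

  count : ℕ → ℕ → ℚ
  count n = Σ₁ (indicator n)

  -- A prime p is coprime to every positive number below it, so multiplying by p leaves divisibility
  -- by their powers unchanged. Adjoining primes in increasing order therefore keeps the new one
  -- independent of the old ones.
  sieve-invariant : ∀ {p} → Prime p → ∀ n {z} → z ℕ.< p → ∀ m → I.sieve (m ℕ.* p) n z ≡ I.sieve m n z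
  sieve-invariant {p} pr n {z} z<p m = ∏₁-cong {z} λ i i<z → cong (λ a → 1ℚ - a) (cover-invariant (suc i) i<z)
    where
    cover-invariant : ∀ q .{{_ : NonZero q}} → q ℕ.≤ z → I.cover (m ℕ.* p) n q ≡ I.cover m n q
    cover-invariant q q≤z = Σ₁-cong {level n q} λ i _ → cong (c q (suc i) *_) (cong₂ _-_ (same (suc i)) (same (suc (suc i))))
      where
      same : ∀ i → dvdPow (m ℕ.* p) q i ≡ dvdPow m q i
      same i = dvd-cong (^∣*⇒^∣ i pr (>⇒∤ (ℕₚ.≤-<-trans q≤z z<p))) (∣m⇒∣m*n p)

  sieve-mean : ∀ n z → HasMean (λ m → I.sieve m n z) (D.sieve n z)
  sieve-mean n zero    = mean-1
  sieve-mean n (suc z) with prime? (suc z)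
  ... | yes pr = mean-cong (λ m → expand (I.sieve m n z) (I.cover m n (suc z))) (expand (D.sieve n z) (D.cover n (suc z)))
    (mean-∸ (sieve-mean n z)
      (mean-mass (suc z) (sieve-invariant pr n ℕₚ.≤-refl) (sieve-mean n z) (c (suc z)) (level n (suc z))))
    where
    expand : ∀ x a → x - x * a ≡ x * (1ℚ - a)
    expand = solve 2 (λ x a → x :- x :* a := x :* (con 1ℚ :- a)) refl
  ... | no ¬pr = mean-cong (λ m → skip (I.sieve m n z) (dvdPow m (suc z))) (skip (D.sieve n z) (recipPow (suc z))) (sieve-mean n z)
    where
    skip : ∀ x w → x ≡ x * (1ℚ - mass (c (suc z)) w (level n (suc z)))
    skip x w = sym (trans (cong (λ a → x * (1ℚ - a)) (mass-zero w (c-¬prime ¬pr) (level n (suc z)))) (*-identityʳ x))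

  -- Exchanging the sums counts incidences prime by prime instead of integer by integer, and each
  -- prime falls under `Σ₁-mass-gap`.
  Σ₁-newCover : m ℕ.≤ n → ∀ N → Σ₁ (λ k → I.newCover k m n) N ≤ ι N * (ι 2 * D.newCover m n)
  Σ₁-newCover {m} {n} m≤n N = begin
    Σ₁ (λ k → I.newCover k m n) N
      ≡⟨ Σ₁-swap (λ k q → I.cover k n q - I.cover k m q) N n ⟩
    Σ₁ (λ q → Σ₁ (λ k → I.cover k n q - I.cover k m q) N) n       ≤⟨ Σ₁-mono {n} (λ q _ → each (suc q)) ⟩
    Σ₁ (λ q → ι N * (ι 2 * (D.cover n q - D.cover m q))) n
      ≡⟨ Σ₁-* (ι N) (λ q → ι 2 * (D.cover n q - D.cover m q)) n ⟩
    ι N * Σ₁ (λ q → ι 2 * (D.cover n q - D.cover m q)) n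
      ≡⟨ cong (ι N *_) (Σ₁-* (ι 2) (λ q → D.cover n q - D.cover m q) n) ⟩
    ι N * (ι 2 * D.newCover m n)                                  ∎
    where
    open ≤-Reasoning
    each : ∀ q → Σ₁ (λ k → I.cover k n q - I.cover k m q) N ≤ ι N * (ι 2 * (D.cover n q - D.cover m q))
    each q with prime? q
    ... | yes pr = Σ₁-mass-gap q {{prime⇒nonTrivial pr}} (c≥0 q) N (level-mono q m≤n)
    ... | no ¬pr = begin
      Σ₁ (λ k → I.cover k n q - I.cover k m q) N         ≡⟨ Σ₁-cong {N} (λ k _ → vanish (dvdPow (suc k) q)) ⟩
      Σ₁ (λ k → 0ℚ * 1ℚ) N                               ≡⟨ Σ₁-* 0ℚ (λ _ → 1ℚ) N ⟩
      0ℚ * Σ₁ (λ _ → 1ℚ) N                               ≡⟨ *-zeroˡ (Σ₁ (λ _ → 1ℚ) N) ⟩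
      0ℚ
        ≡⟨ solve 2 (λ n t → con 0ℚ := n :* (t :* con 0ℚ)) refl (ι N) (ι 2) ⟩
      ι N * (ι 2 * 0ℚ)
        ≡⟨ cong (λ t → ι N * (ι 2 * t)) (vanish (recipPow q)) ⟨
      ι N * (ι 2 * (D.cover n q - D.cover m q))          ∎
      where
      vanish : ∀ w → mass (c q) w (level n q) - mass (c q) w (level m q) ≡ 0ℚ
      vanish w = cong₂ _-_ (mass-zero w (c-¬prime ¬pr) (level n q)) (mass-zero w (c-¬prime ¬pr) (level m q))

  count-antitone : m ℕ.≤ n → ∀ N → count n N ≤ count m N
  count-antitone m≤n N = Σ₁-mono {N} λ k _ → I.sieve-diagonal-antitone (suc k) m≤n

  count≥0 : ∀ n N → 0ℚ ≤ count n N
  count≥0 n N = Σ₁-grows (λ k → I.sieve≥0 k n n) (ℕ.z≤n {N})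

  count-gap : ∀ {n N} → n ℕ.≤ N → (count n N - count N N) * density N ≤ ι N * (ι 2 * (density n - density N))
  count-gap {n} {N} n≤N = begin
    (count n N - count N N) * density N
      ≡⟨ cong (_* density N) (Σ₁-∸ (indicator n) (indicator N) N) ⟨
    Σ₁ (λ k → indicator n k - indicator N k) N * density N
      ≤⟨ *-monoʳ-≤-0≤ (D.sieve≥0 N N) (≤-trans (Σ₁-mono {N} (λ k _ → I.sieve-lipschitz (suc k) n≤N)) (Σ₁-newCover n≤N N)) ⟩
    ι N * (ι 2 * D.newCover n N) * density N
      -- This is 2 N times `D.sieve-gap`: newCover times density N is at most the loss of density,
      -- however large newCover is.
      ≤⟨ 0≤⇒≤ (*-0≤ (ι≥0 N) (*-0≤ (ι≥0 2) (p≤q⇒0≤q-p (D.sieve-gap n≤N))))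
           (solve 5 (λ k t s f f′ → k :* (t :* (f :- f′)) := k :* (t :* s) :* f′ :+ k :* (t :* (f :- f′ :* (con 1ℚ :+ s))))
             refl (ι N) (ι 2) (D.newCover n N) (density n) (density N)) ⟩
    ι N * (ι 2 * (density n - density N)) ∎
    where open ≤-Reasoning

  module _ (em : ExcludedMiddle 0ℓ) where

    density-cauchy : IsCauchy density
    density-cauchy = antitone⇒cauchy em density D.sieve-diagonal-antitone (λ n → D.sieve≥0 n n)

    private
      settle : ∀ {δ} → 0ℚ < δ → ∃[ n ] (∀ N → n ℕ.≤ N → density n - density N ≤ δ)
      settle {δ} δ>0 = let n , close = density-cauchy δ δ>0 in
        n , λ N n≤N → ≤-trans (p≤∣p∣ (density n - density N)) (<⇒≤ (close n N ℕₚ.≤-refl n≤N))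

    -- Sieving further only removes integers, so the count at a fixed level n bounds it. One half of
    -- ε covers density n - density N, the other absorbs the constant error at level n.
    count-upper : ∀ {ε} → 0ℚ < ε → Eventually (λ N → count N N - density N * ι N ≤ ι N * ε)
    count-upper {ε} ε>0 =
      let
        n , close = settle (half ε>0)
        hasMean B mean = sieve-mean n n
        K , B≤ = eventually-≤ι* B (half ε>0)
      in n ℕ.⊔ K , λ N n⊔K≤N →
      let
        n≤N = ℕₚ.m⊔n≤o⇒m≤o n K n⊔K≤N
        K≤N = ℕₚ.m⊔n≤o⇒n≤o n K n⊔K≤N
      in 0≤⇒≤
        (+-0≤ (+-0≤ (p≤q⇒0≤q-p (count-antitone n≤N N))
                    (p≤q⇒0≤q-p (≤-trans (p≤∣p∣ (count n N - density n * ι N)) (mean N))))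
              (+-0≤ (p≤q⇒0≤q-p (B≤ N K≤N)) (*-0≤ (ι≥0 N) (p≤q⇒0≤q-p (close N n≤N)))))
        (solve 7 (λ k e b C C′ d d′ → k :* e := (C′ :- d′ :* k) :+
            (((C :- C′) :+ (b :- (C :- d :* k))) :+ ((k :* (con ½ :* e) :- b) :+ k :* (con ½ :* e :- (d :- d′))))) refl
          (ι N) ε B (count n N) (count N N) (density n) (density N))

    -- Without a lower bound on the density count-gap is void, but then the
    -- density itself is below ε and the claim is trivial.
    count-lower : ∀ {ε} → 0ℚ < ε → Eventually (λ N → density N * ι N - count N N ≤ ι N * ε)
    count-lower {ε} ε>0 with em {∃[ n ] density n < ε}
    ... | yes (n , dn<ε) = n , λ N n≤N → 0≤⇒≤
      (+-0≤ (*-0≤ (ι≥0 N) (p≤q⇒0≤q-p (≤-trans (D.sieve-diagonal-antitone n≤N) (<⇒≤ dn<ε)))) (count≥0 N N))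
      (solve 4 (λ k e C d → k :* e := (d :* k :- C) :+ (k :* (e :- d) :+ C)) refl (ι N) ε (count N N) (density N))
    ... | no large =
      let
        -- The tolerance is ε²/4: with density N ≥ ε, `count-gap` bounds the removed integers by 2 N
        -- (ε²/4) / ε = N ε / 2.
        n , close = settle (half (pos* (half ε>0) ε>0))
        hasMean B mean = sieve-mean n n
        K , B≤ = eventually-≤ι* B (half ε>0)
      in n ℕ.⊔ K , λ N n⊔K≤N →
      let
        n≤N = ℕₚ.m⊔n≤o⇒m≤o n K n⊔K≤N
        K≤N = ℕₚ.m⊔n≤o⇒n≤o n K n⊔K≤N
      in 0≤⇒≤
        (+-0≤ (+-0≤ (p≤q⇒0≤q-p (gap N n≤N (close N n≤N)))
                    (p≤q⇒0≤q-p (≤-trans (-p≤∣p∣ (count n N - density n * ι N)) (mean N))))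
              (+-0≤ (p≤q⇒0≤q-p (B≤ N K≤N)) (*-0≤ (ι≥0 N) (p≤q⇒0≤q-p (D.sieve-diagonal-antitone n≤N)))))
        (solve 7 (λ k e b C C′ d d′ → k :* e := (d′ :* k :- C′) :+
            (((k :* (con ½ :* e) :- (C :- C′)) :+ (b :- (:- (C :- d :* k)))) :+ ((k :* (con ½ :* e) :- b) :+ k :* (d :- d′)))) refl
          (ι N) ε B (count n N) (count N N) (density n) (density N))
      where
      open ≤-Reasoning
      gap : ∀ {n} N → n ℕ.≤ N → density n - density N ≤ ½ * (½ * ε * ε) → count n N - count N N ≤ ι N * (½ * ε)
      gap {n} N n≤N close = *-cancelʳ-≤-pos ε {{positive ε>0}} (begin
        (count n N - count N N) * ε
          ≤⟨ *-monoˡ-≤-0≤ (p≤q⇒0≤q-p (count-antitone n≤N N)) (≮⇒≥ λ dN<ε → large (N , dN<ε)) ⟩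
        (count n N - count N N) * density N
          ≤⟨ count-gap n≤N ⟩
        ι N * (ι 2 * (density n - density N))
          ≤⟨ *-monoˡ-≤-0≤ (ι≥0 N) (*-monoˡ-≤-0≤ (ι≥0 2) close) ⟩
        ι N * (ι 2 * (½ * (½ * ε * ε)))
          ≡⟨ cong (λ t → ι N * (t * (½ * (½ * ε * ε)))) (trans (ι-suc 1) (cong (_+ 1ℚ) ι-1)) ⟩
        ι N * ((1ℚ + 1ℚ) * (½ * (½ * ε * ε)))
          ≡⟨ solve 2 (λ k e → k :* ((con 1ℚ :+ con 1ℚ) :* (con ½ :* (con ½ :* e :* e))) := k :* (con ½ :* e) :* e) refl (ι N) ε ⟩
        ι N * (½ * ε) * ε ∎)

    count≈density : ∀ {ε} → 0ℚ < ε → Eventually (λ N → ∣ count N N - density N * ι N ∣ ≤ ι N * ε)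
    count≈density {ε} ε>0 = let N₀ , both = eventually-× (count-upper ε>0) (count-lower ε>0) in
      N₀ , λ N N₀≤N → ∣p∣≤ (proj₁ (both N N₀≤N)) (≤-trans
        (≤-reflexive (solve 2 (λ a b → :- (a :- b) := b :- a) refl (count N N) (density N * ι N)))
        (proj₂ (both N N₀≤N)))

-- The function g

multiplicity : ℙ → List ℙ → ℕ
multiplicity p ps = length (filter (Defs._≟_ p) ps)

multiplicity-≡ : ∀ p ps → multiplicity p (p ∷ ps) ≡ suc (multiplicity p ps)
multiplicity-≡ p ps = cong length (filter-accept (Defs._≟_ p) refl)

multiplicity-≢ : ∀ {p r} → ¬ p ≡ r → ∀ ps → multiplicity p (r ∷ ps) ≡ multiplicity p ps
multiplicity-≢ {p} p≢r ps = cong length (filter-reject (Defs._≟_ p) p≢r)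

value-prime : (p : ℙ) → Prime (value p)
value-prime (p , [ pr ]) = recompute (prime? p) pr

prime≢⇒∤ : ∀ {p q} → Prime p → Prime q → ¬ p ≡ q → ¬ p ∣ q
prime≢⇒∤ p-prime q-prime p≢q p∣q =
  [ (λ { refl → ¬prime[1] p-prime }) , p≢q ]′ (prime⇒irreducible q-prime p∣q)

≤multiplicity⇒^∣ : ∀ p ps i → i ℕ.≤ multiplicity p ps → value p ^ i ∣ ∏ₗ (map value ps)
≤multiplicity⇒^∣ p ps       zero    i≤ = 1∣ _
≤multiplicity⇒^∣ p (r ∷ ps) (suc i) i≤ with p Defs.≟ r
... | yes refl = *-monoʳ-∣ (value p) (≤multiplicity⇒^∣ p ps i (ℕ.s≤s⁻¹ (subst (suc i ℕ.≤_) (multiplicity-≡ p ps) i≤)))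
... | no  p≢r  = ∣n⇒∣m*n (value r) (≤multiplicity⇒^∣ p ps (suc i) (subst (suc i ℕ.≤_) (multiplicity-≢ p≢r ps) i≤))

^∣⇒≤multiplicity : ∀ p ps i → value p ^ i ∣ ∏ₗ (map value ps) → i ℕ.≤ multiplicity p ps
^∣⇒≤multiplicity p ps       zero    p^i∣ = ℕ.z≤n
^∣⇒≤multiplicity p []       (suc i) p^i∣ = contradiction
  (subst Prime (∣1⇒≡1 (∣-trans (m∣m*n (value p ^ i)) p^i∣)) (value-prime p)) ¬prime[1]
^∣⇒≤multiplicity p (r ∷ ps) (suc i) p^i∣ with p Defs.≟ r
... | yes refl = subst (suc i ℕ.≤_) (sym (multiplicity-≡ p ps)) (ℕ.s≤s (^∣⇒≤multiplicity p ps i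
  (*-cancelˡ-∣ (value p) {{prime⇒nonZero (value-prime p)}} p^i∣)))
... | no  p≢r  = subst (suc i ℕ.≤_) (sym (multiplicity-≢ p≢r ps)) (^∣⇒≤multiplicity p ps (suc i)
  (^∣*⇒^∣ (suc i) (value-prime r)
    (prime≢⇒∤ (value-prime r) (value-prime p) λ { refl → p≢r refl })
    (subst (value p ^ suc i ∣_) (ℕₚ.*-comm (value r) (∏ₗ (map value ps))) p^i∣)))

∏ₗ-primeFactors : ∀ u → ∏ₗ (map value (primeFactors u)) ≡ value u
∏ₗ-primeFactors (suc n , _) = trans (cong ∏ₗ (forget (PrimeFactorisation.factorsPrime F))) (sym (PrimeFactorisation.isFactorisation F))
  where
  F = factorise (suc n)
  forget : ∀ {ps} (prs : All Prime ps) → map value (All.reduce (λ {p} p-prime → _,_ {P = Prime} p [ p-prime ]) prs) ≡ ps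
  forget []         = refl
  forget (pr ∷ prs) = cong (_ ∷_) (forget prs)

≤exponent⇒^∣ : ∀ u p {i} → i ℕ.≤ exponent u p → value p ^ i ∣ value u
≤exponent⇒^∣ u p {i} i≤ = subst (value p ^ i ∣_) (∏ₗ-primeFactors u) (≤multiplicity⇒^∣ p (primeFactors u) i i≤)

^∣⇒≤exponent : ∀ u p {i} → value p ^ i ∣ value u → i ℕ.≤ exponent u p
^∣⇒≤exponent u p {i} p^i∣u = ^∣⇒≤multiplicity p (primeFactors u) i
  (subst (value p ^ i ∣_) (sym (∏ₗ-primeFactors u)) p^i∣u)

multiplicity>0⇒∈ : ∀ p ps → 0 ℕ.< multiplicity p ps → p ∈ ps
multiplicity>0⇒∈ p (r ∷ ps) 0< with p Defs.≟ r
... | yes refl = here refl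
... | no  p≢r  = there (multiplicity>0⇒∈ p ps (subst (0 ℕ.<_) (multiplicity-≢ p≢r ps) 0<))

∈⇒multiplicity>0 : ∀ {p ps} → p ∈ ps → 0 ℕ.< multiplicity p ps
∈⇒multiplicity>0 {p} {r ∷ ps} p∈ with p Defs.≟ r | p∈
... | yes refl | _         = subst (0 ℕ.<_) (sym (multiplicity-≡ p ps)) (ℕ.s≤s ℕ.z≤n)
... | no p≢r   | here p≡r  = contradiction p≡r p≢r
... | no p≢r   | there p∈′ = subst (0 ℕ.<_) (sym (multiplicity-≢ p≢r ps)) (∈⇒multiplicity>0 p∈′)

n<m^n : ∀ m .{{_ : ℕ.NonTrivial m}} n → n ℕ.< m ^ n
n<m^n m zero    = ℕ.s≤s ℕ.z≤n
n<m^n m (suc n) = ℕₚ.≤-trans (ℕ.s≤s (n<m^n m n)) (ℕₚ.≤-trans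
  (ℕₚ.+-mono-≤ (ℕₚ.m^n>0 m {{ℕ.nonTrivial⇒nonZero m}} n) (ℕₚ.m≤m+n (m ^ n) 0))
  (ℕₚ.*-monoˡ-≤ (m ^ n) (ℕ.nonTrivial⇒n>1 m)))

-- From e < pᵉ ≤ u. It makes the truncation of exponents at N harmless for all u ≤ N.
exponent≤ : ∀ u p → exponent u p ℕ.≤ value u
exponent≤ u@(suc _ , _) p = ℕₚ.≤-trans
  (ℕₚ.<⇒≤ (n<m^n (value p) {{prime⇒nonTrivial (value-prime p)}} (exponent u p)))
  (∣⇒≤ (≤exponent⇒^∣ u p ℕₚ.≤-refl))

-- A step weight drops only after e, so the sum keeps the single term c e. For e = 0 that term lies
-- outside the range of summation, hence the condition on c 0.
mass-step : ∀ c {w e} → c 0 ≡ 0ℚ → (∀ i → i ℕ.≤ e → w i ≡ 1ℚ) → (∀ i → e ℕ.< i → w i ≡ 0ℚ) →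
            ∀ k → (k ℕ.< e → mass c w k ≡ 0ℚ) × (e ℕ.≤ k → mass c w k ≡ c e)
mass-step c c0 one nil zero = (λ _ → refl) , λ e≤0 → sym (trans (cong c (ℕₚ.n≤0⇒n≡0 e≤0)) c0)
mass-step c {w} {e} c0 one nil (suc k) = below , above
  where
  IH = mass-step c {w} c0 one nil k
  flat : ∀ {a b x y} → a ≡ b → x ≡ y → a + c (suc k) * (x - y) ≡ b
  flat {a} {x = x} refl refl = solve 3 (λ a c x → a :+ c :* (x :- x) := a) refl a (c (suc k)) x
  below : suc k ℕ.< e → mass c w (suc k) ≡ 0ℚ
  below k< = flat (proj₁ IH (ℕₚ.<⇒≤ k<)) (trans (one _ (ℕₚ.<⇒≤ k<)) (sym (one _ k<)))
  above : e ℕ.≤ suc k → mass c w (suc k) ≡ c e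
  above e≤ with ℕₚ.m≤n⇒m<n∨m≡n e≤
  ... | inj₁ (ℕ.s≤s e≤k) = flat (proj₂ IH e≤k) (trans (nil _ (ℕ.s≤s e≤k)) (sym (nil _ (ℕ.s≤s (ℕₚ.m≤n⇒m≤1+n e≤k)))))
  ... | inj₂ refl = trans (cong₂ (λ a b → a + c (suc k) * b) (proj₁ IH ℕₚ.≤-refl) (cong₂ _-_ (one _ ℕₚ.≤-refl) (nil _ ℕₚ.≤-refl)))
    (solve 1 (λ c → con 0ℚ :+ c :* (con 1ℚ :- con 0ℚ) := c) refl (c (suc k)))

∏₁-ones : ∀ n {f} → (∀ i → i ℕ.< n → f (suc i) ≡ 1ℚ) → ∏₁ f n ≡ 1ℚ
∏₁-ones zero    one = refl
∏₁-ones (suc n) one = cong₂ _*_ (∏₁-ones n (λ i i<n → one i (ℕₚ.m<n⇒m<1+n i<n))) (one n ℕₚ.≤-refl)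

∏₁-zero : ∀ n {f} i → i ℕ.< n → f (suc i) ≡ 0ℚ → ∏₁ f n ≡ 0ℚ
∏₁-zero (suc n) {f} i i<1+n nil with ℕₚ.m≤n⇒m<n∨m≡n i<1+n
... | inj₁ (ℕ.s≤s i<n) = trans (cong (_* f (suc n)) (∏₁-zero n i i<n nil)) (*-zeroˡ (f (suc n)))
... | inj₂ refl        = trans (cong (∏₁ f n *_) nil) (*-zeroʳ (∏₁ f n))

sum-map≡0 : ∀ {A : Set} (f : A → ℕ) {xs x} → sum (map f xs) ≡ 0 → x ∈ xs → f x ≡ 0
sum-map≡0 f {y ∷ _} eq (here refl) = ℕₚ.m+n≡0⇒m≡0 (f y) eq
sum-map≡0 f {y ∷ _} eq (there x∈)  = sum-map≡0 f (ℕₚ.m+n≡0⇒n≡0 (f y) eq) x∈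

sum-map≢0 : ∀ {A : Set} (f : A → ℕ) xs → ¬ sum (map f xs) ≡ 0 → ∃[ x ] x ∈ xs × ¬ f x ≡ 0
sum-map≢0 f []       ≢0 = contradiction refl ≢0
sum-map≢0 f (x ∷ xs) ≢0 with f x ℕₚ.≟ 0
... | no  fx≢0 = x , here refl , fx≢0
... | yes fx≡0 = let y , y∈ , fy≢0 = sum-map≢0 f xs (λ eq → ≢0 (cong₂ ℕ._+_ fx≡0 eq)) in y , there y∈ , fy≢0

-- The sieve attached to h

module Coefficients (h : ℤ₊ × ℙ → Fin 2) where

  coeff : ℕ → ℕ → ℚ
  coeff q i with prime? q
  ... | yes q-prime = ι (h₀ h i (q , [ q-prime ]))
  ... | no  _       = 0ℚ

  h₀≤1 : ∀ i p → h₀ h i p ℕ.≤ 1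
  h₀≤1 zero    p = ℕ.z≤n
  h₀≤1 (suc i) p = toℕ≤pred[n] (h (1+ i , p))

  coeff≥0 : ∀ q i → 0ℚ ≤ coeff q i
  coeff≥0 q i with prime? q
  ... | yes q-prime = ι≥0 (h₀ h i (q , [ q-prime ]))
  ... | no  _       = ≤-refl

  coeff≤1 : ∀ q i → coeff q i ≤ 1ℚ
  coeff≤1 q i with prime? q
  ... | yes q-prime = subst (ι (h₀ h i (q , [ q-prime ])) ≤_) ι-1 (ι-mono (h₀≤1 i (q , [ q-prime ])))
  ... | no  _       = 0≤1

  coeff-prime : ∀ p i → coeff (value p) i ≡ ι (h₀ h i p)
  coeff-prime p@(q , [ q-prime ]) i with prime? q
  ... | yes _  = refl
  ... | no ¬pr = contradiction (value-prime p) ¬pr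

  coeff-¬prime : ∀ {q} → ¬ Prime q → ∀ i → coeff q i ≡ 0ℚ
  coeff-¬prime {q} ¬pr i with prime? q
  ... | yes pr = contradiction pr ¬pr
  ... | no  _  = refl

  open Sieve coeff coeff≥0 coeff≤1 coeff-¬prime public

  cover-prime : ∀ u {N} → value u ℕ.≤ N → ∀ p → value p ℕ.≤ N →
                I.cover (value u) N (value p) ≡ ι (h₀ h (exponent u p) p)
  cover-prime u {N} u≤N p p≤N = trans (cong (mass (coeff (value p)) (dvdPow (value u) (value p))) (level-≤ p≤N)) (trans
    (proj₂ (mass-step (coeff (value p)) (trans (coeff-prime p 0) ι-0)
      (λ i i≤ → dvd-yes (≤exponent⇒^∣ u p i≤))
      (λ i >i → dvd-no (λ p^i∣ → ℕₚ.<⇒≱ >i (^∣⇒≤exponent u p p^i∣))) N)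
      (ℕₚ.≤-trans (exponent≤ u p) u≤N))
    (coeff-prime p (exponent u p)))

  indicator-g≡0 : ∀ u {N} → value u ℕ.≤ N → g h u ≡ 0 → indicator N (value u) ≡ 1ℚ
  indicator-g≡0 u {N} u≤N g≡0 = ∏₁-ones N λ i i<N → cong (λ a → 1ℚ - a) (uncovered (suc i) i<N (prime? (suc i)))
    where
    h₀≡0 : ∀ p → h₀ h (exponent u p) p ≡ 0
    -- Primes not dividing u are absent from the sum defining g; for them the value 0 of `h₀` at
    -- exponent 0 takes over.
    h₀≡0 p with exponent u p in eq
    ... | zero  = refl
    ... | suc e = trans (cong (λ a → h₀ h a p) (sym eq)) (sum-map≡0 (λ p → h₀ h (exponent u p) p) g≡0
      (∈-deduplicate⁺ Defs._≟_ (multiplicity>0⇒∈ p (primeFactors u) (subst (0 ℕ.<_) (sym eq) (ℕ.s≤s ℕ.z≤n)))))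
    uncovered : ∀ q → q ℕ.≤ N → Dec (Prime q) → I.cover (value u) N q ≡ 0ℚ
    uncovered q q≤N (yes pr) = trans (cover-prime u u≤N (q , [ pr ]) q≤N) (trans (cong ι (h₀≡0 (q , [ pr ]))) ι-0)
    uncovered q q≤N (no ¬pr) = mass-zero (dvdPow (value u) q) (coeff-¬prime ¬pr) (level N q)

  indicator-g≢0 : ∀ u {N} → value u ℕ.≤ N → ¬ g h u ≡ 0 → indicator N (value u) ≡ 0ℚ
  indicator-g≢0 u@(suc _ , _) {N} u≤N g≢0 = kill p p≤N covered
    where
    found = sum-map≢0 (λ p → h₀ h (exponent u p) p) (deduplicate Defs._≟_ (primeFactors u)) g≢0
    p = proj₁ found
    p∈ = ∈-deduplicate⁻ Defs._≟_ (primeFactors u) (proj₁ (proj₂ found))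
    p≤N : value p ℕ.≤ N
    p≤N = ℕₚ.≤-trans (∣⇒≤ (subst (_∣ value u) (ℕₚ.*-identityʳ (value p)) (≤exponent⇒^∣ u p (∈⇒multiplicity>0 p∈)))) u≤N
    covered : I.cover (value u) N (value p) ≡ 1ℚ
    covered = trans (cover-prime u u≤N p p≤N) (trans (cong ι (ℕₚ.≤-antisym (h₀≤1 (exponent u p) p) (ℕₚ.n≢0⇒n>0 (proj₂ (proj₂ found))))) ι-1)
    kill : ∀ p → value p ℕ.≤ N → I.cover (value u) N (value p) ≡ 1ℚ → indicator N (value u) ≡ 0ℚ
    kill p@(zero , _)  q<N eq = contradiction (value-prime p) ¬prime[0]
    kill (suc q , _)   q<N eq = ∏₁-zero N q q<N (cong (λ a → 1ℚ - a) eq)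

  -- The level N stays fixed while the induction shortens the list; k ≤ N keeps every listed integer
  -- within reach of that level.
  length-g≡0 : ∀ {N k} → k ℕ.≤ N → ι (length (filter (λ n → g h n ℕₚ.≟ 0) (applyUpTo 1+_ k))) ≡ count N k
  length-g≡0 {N} {zero}  k≤N = ι-0
  length-g≡0 {N} {suc k} k≤N = begin
    ι (length (filter P? (applyUpTo 1+_ (suc k))))
      ≡⟨ cong (ι ∘ length ∘ filter P?) (applyUpTo-∷ʳ 1+_ k) ⟨
    ι (length (filter P? (applyUpTo 1+_ k ++ (1+ k) ∷ [])))
      ≡⟨ cong (ι ∘ length) (filter-++ P? (applyUpTo 1+_ k) ((1+ k) ∷ [])) ⟩
    ι (length (filter P? (applyUpTo 1+_ k) ++ filter P? ((1+ k) ∷ [])))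
      ≡⟨ cong ι (length-++ (filter P? (applyUpTo 1+_ k))) ⟩
    ι (length (filter P? (applyUpTo 1+_ k)) ℕ.+ length (filter P? ((1+ k) ∷ [])))
      ≡⟨ ι-+ (length (filter P? (applyUpTo 1+_ k))) (length (filter P? ((1+ k) ∷ []))) ⟩
    ι (length (filter P? (applyUpTo 1+_ k))) + ι (length (filter P? ((1+ k) ∷ [])))
      ≡⟨ cong₂ _+_ (length-g≡0 (ℕₚ.<⇒≤ k≤N)) last ⟩
    count N k + indicator N (suc k)                                              ∎
    where
    open ≡-Reasoning
    P? = λ n → g h n ℕₚ.≟ 0
    last : ι (length (filter P? ((1+ k) ∷ []))) ≡ indicator N (suc k)
    last with g h (1+ k) ℕₚ.≟ 0
    ... | yes g≡0 = trans (cong (ι ∘ length) (filter-accept P? {1+ k} {[]} g≡0)) (trans ι-1 (sym (indicator-g≡0 (1+ k) k≤N g≡0)))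
    ... | no  g≢0 = trans (cong (ι ∘ length) (filter-reject P? {1+ k} {[]} g≢0)) (trans ι-0 (sym (indicator-g≢0 (1+ k) k≤N g≢0)))

-- Integer parts of reals

/≡ι*recip : ∀ a n .{{_ : NonZero n}} → ℤ.+ a / n ≡ ι a * recip (ι n)
/≡ι*recip a n = begin
  ℤ.+ a / n                           ≡⟨ *-identityʳ (ℤ.+ a / n) ⟨
  (ℤ.+ a / n) * 1ℚ                    ≡⟨ cong ((ℤ.+ a / n) *_) (*-recip (ι>0 n)) ⟨
  (ℤ.+ a / n) * (ι n * recip (ι n))   ≡⟨ *-assoc (ℤ.+ a / n) (ι n) (recip (ι n)) ⟨
  (ℤ.+ a / n) * ι n * recip (ι n)     ≡⟨ cong (_* recip (ι n)) (/-*-ι a n) ⟩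
  ι a * recip (ι n)                   ∎
  where open ≡-Reasoning

-- The real ε is replaced by a rational e eventually below it. Half of e bounds the distance, the
-- other half is the margin that `<` on reals demands.
close⇒∣-∣< : ∀ {ε} (ε>0 : 0ℝ Real.< ε) x y →
             Eventually (λ k → ∣ seq x k - seq y k ∣ ≤ ½ * proj₁ ε>0) → Real.∣ x Real.- y ∣ Real.< ε
close⇒∣-∣< {ε} (e , e>0 , K , e≤ε) x y (N , close) = ½ * e , half e>0 , K ℕ.⊔ N , λ k ≤k → begin
  ∣ seq x k - seq y k ∣ + ½ * e   ≤⟨ +-monoˡ-≤ (½ * e) (close k (ℕₚ.m⊔n≤o⇒n≤o K N ≤k)) ⟩
  ½ * e + ½ * e                   ≡⟨ trans (halves e) (sym (+-identityˡ e)) ⟩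
  0ℚ + e                          ≤⟨ e≤ε k (ℕₚ.m⊔n≤o⇒m≤o K N ≤k) ⟩
  seq ε k                         ∎
  where open ≤-Reasoning

fromℕ-≤-down : ∀ {x} → m ℕ.≤ n → fromℕ n Real.≤ x → fromℕ m Real.≤ x
fromℕ-≤-down {m} {n} m≤n n≤x (e , e>0 , K , x+e≤m) = n≤x (e , e>0 , K , λ k K≤k →
  ≤-trans (x+e≤m k K≤k) (subst₂ _≤_ (sym (ι-def m)) (sym (ι-def n)) (ι-mono m≤n)))

positive⇒0≤ : ∀ {x} → 0ℝ Real.< x → fromℕ 0 Real.≤ x
positive⇒0≤ {x} (e , e>0 , K , e≤x) (e′ , e′>0 , K′ , x+e′≤0) = <-irrefl refl (begin-strict
  0ℚ                          <⟨ +-mono-< e>0 e′>0 ⟩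
  e + e′                      ≡⟨ cong (_+ e′) (+-identityˡ e) ⟨
  0ℚ + e + e′                 ≤⟨ +-monoˡ-≤ e′ (e≤x (K ℕ.⊔ K′) (ℕₚ.m≤m⊔n K K′)) ⟩
  seq x (K ℕ.⊔ K′) + e′       ≤⟨ x+e′≤0 (K ℕ.⊔ K′) (ℕₚ.m≤n⊔m K K′) ⟩
  0ℚ                          ∎)
  where open ≤-Reasoning

-- Through `listing`, both Q and the product over primes depend on x only through its integer part.
record Floor (em : ExcludedMiddle 0ℓ) (x : ℝ) : Set where
  field
    ⌊x⌋     : ℕ
    listing : integersUpTo em x ≡ applyUpTo 1+_ ⌊x⌋
    lower   : fromℕ ⌊x⌋ Real.≤ x
    upper   : x Real.< fromℕ (suc ⌊x⌋)

  greatest : fromℕ m Real.≤ x → m ℕ.≤ ⌊x⌋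
  greatest m≤x = ℕₚ.≮⇒≥ λ ⌊x⌋<m → fromℕ-≤-down {x = x} ⌊x⌋<m m≤x upper

  eventually-near : Eventually (λ k → ∣ seq x k - ι ⌊x⌋ ∣ ≤ 1ℚ)
  eventually-near =
    let
      K , close = cauchy x ½ (positive⁻¹ ½)
      e , e>0 , K′ , x+e≤ = upper
    in K ℕ.⊔ K′ , λ k ≤k →
    let
      K≤k = ℕₚ.m⊔n≤o⇒m≤o K K′ ≤k
      above = begin
        seq x k                      ≤⟨ 0≤⇒≤ (<⇒≤ e>0) refl ⟩
        seq x k + e                  ≤⟨ x+e≤ k (ℕₚ.m⊔n≤o⇒n≤o K K′ ≤k) ⟩
        ℤ.+ suc ⌊x⌋ / 1              ≡⟨ trans (ι-def (suc ⌊x⌋)) (ι-suc ⌊x⌋) ⟩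
        ι ⌊x⌋ + 1ℚ                   ∎
      -- As `lower` is a negation, it gives no direct bound on the terms. If one late term were
      -- below ⌊x⌋ - 1, then by the Cauchy property all late terms would be at most ⌊x⌋ - ½, against
      -- `lower`.
      below = ≮⇒≥ λ xk<⌊x⌋-1 → lower (½ , positive⁻¹ ½ , K , λ n K≤n → begin
        seq x n + ½
          ≡⟨ solve 2 (λ a b → a :+ con ½ := (a :- b) :+ b :+ con ½) refl (seq x n) (seq x k) ⟩
        seq x n - seq x k + seq x k + ½
          ≤⟨ +-monoˡ-≤ ½ (+-mono-≤ (≤-trans (p≤∣p∣ (seq x n - seq x k)) (<⇒≤ (close n k K≤n K≤k))) (<⇒≤ xk<⌊x⌋-1)) ⟩
        ½ + (ι ⌊x⌋ - 1ℚ) + ½         ≡⟨ solve 1 (λ a → con ½ :+ (a :- con 1ℚ) :+ con ½ := a) refl (ι ⌊x⌋) ⟩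
        ι ⌊x⌋                        ≡⟨ ι-def ⌊x⌋ ⟨
        ℤ.+ ⌊x⌋ / 1                  ∎)
    in ∣p∣≤
      (≤-trans (+-monoˡ-≤ (- ι ⌊x⌋) above) (≤-reflexive (solve 1 (λ a → a :+ con 1ℚ :- a := con 1ℚ) refl (ι ⌊x⌋))))
      (0≤⇒≤ (p≤q⇒0≤q-p below) (solve 2 (λ a b → con 1ℚ := :- (b :- a) :+ (b :- (a :- con 1ℚ))) refl (ι ⌊x⌋) (seq x k)))
    where open ≤-Reasoning

floor : ∀ (em : ExcludedMiddle 0ℓ) x → 0ℝ Real.< x → Floor em x
floor em x x>0 = let N , eq , N≤b , N≤x , next = go (crudeBound x) in record
  { ⌊x⌋     = N
  ; listing = eq
  ; lower   = N≤x
  ; upper   = above N≤b next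
  }
  where
  Below : ℕ → Set
  Below n = fromℕ n Real.≤ x

  above : ∀ {N} → N ℕ.≤ crudeBound x → (N ℕ.< crudeBound x → ¬ Below (suc N)) → x Real.< fromℕ (suc N)
  -- Since `≤` on reals is the negation of the reversed `<`, the negative case is `Below (suc N)`
  -- itself; then `suc N` is within `crudeBound x`, where `next` excludes it.
  above {N} N≤b next with em {x Real.< fromℕ (suc N)}
  ... | yes x<1+N = x<1+N
  ... | no  1+N≤x = let 1+N≤b = ≤crudeBound (suc N) x 1+N≤x in contradiction 1+N≤x (next 1+N≤b)

  -- The last component says that a scan stopping short of b was stopped by `suc N`. As `Below` is
  -- downward closed, a later accepted integer forces N = b, so the filtered list has no gaps.
  go : ∀ b → ∃[ N ] filter (atMost? em x) (applyUpTo 1+_ b) ≡ applyUpTo 1+_ N ×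
             N ℕ.≤ b × Below N × (N ℕ.< b → ¬ Below (suc N))
  go zero    = 0 , refl , ℕ.z≤n , positive⇒0≤ {x} x>0 , λ ()
  go (suc b) with go b | em {Below (suc b)}
  ... | N , eq , N≤b , N≤x , next | yes 1+b≤x = suc b , list , ℕₚ.≤-refl , 1+b≤x , λ lt → contradiction lt (ℕₚ.<-irrefl refl)
    where
    N≡b : N ≡ b
    N≡b = ℕₚ.≤-antisym N≤b (ℕₚ.≮⇒≥ λ N<b → next N<b (fromℕ-≤-down {x = x} (ℕ.s≤s (ℕₚ.<⇒≤ N<b)) 1+b≤x))
    open ≡-Reasoning
    list : filter (atMost? em x) (applyUpTo 1+_ (suc b)) ≡ applyUpTo 1+_ (suc b)
    list = begin
      filter (atMost? em x) (applyUpTo 1+_ (suc b))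
        ≡⟨ cong (filter (atMost? em x)) (applyUpTo-∷ʳ 1+_ b) ⟨
      filter (atMost? em x) (applyUpTo 1+_ b ++ (1+ b) ∷ [])
        ≡⟨ filter-++ (atMost? em x) (applyUpTo 1+_ b) ((1+ b) ∷ []) ⟩
      filter (atMost? em x) (applyUpTo 1+_ b) ++ filter (atMost? em x) ((1+ b) ∷ [])
        ≡⟨ cong₂ _++_ (trans eq (cong (applyUpTo 1+_) N≡b)) (filter-accept (atMost? em x) {1+ b} {[]} 1+b≤x) ⟩
      applyUpTo 1+_ b ++ (1+ b) ∷ []                                         ≡⟨ applyUpTo-∷ʳ 1+_ b ⟩
      applyUpTo 1+_ (suc b)                                                  ∎
  ... | N , eq , N≤b , N≤x , next | no 1+b≰x = N , list , ℕₚ.m≤n⇒m≤1+n N≤b , N≤x , next′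
    where
    open ≡-Reasoning
    list : filter (atMost? em x) (applyUpTo 1+_ (suc b)) ≡ applyUpTo 1+_ N
    list = begin
      filter (atMost? em x) (applyUpTo 1+_ (suc b))
        ≡⟨ cong (filter (atMost? em x)) (applyUpTo-∷ʳ 1+_ b) ⟨
      filter (atMost? em x) (applyUpTo 1+_ b ++ (1+ b) ∷ [])
        ≡⟨ filter-++ (atMost? em x) (applyUpTo 1+_ b) ((1+ b) ∷ []) ⟩
      filter (atMost? em x) (applyUpTo 1+_ b) ++ filter (atMost? em x) ((1+ b) ∷ [])
        ≡⟨ cong₂ _++_ eq (filter-reject (atMost? em x) {1+ b} {[]} 1+b≰x) ⟩
      applyUpTo 1+_ N ++ []
        ≡⟨ ++-identityʳ (applyUpTo 1+_ N) ⟩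
      applyUpTo 1+_ N                                                        ∎
    next′ : N ℕ.< suc b → ¬ Below (suc N)
    next′ N<1+b with ℕₚ.m≤n⇒m<n∨m≡n N≤b
    ... | inj₁ N<b  = next N<b
    ... | inj₂ refl = 1+b≰x

-- Limits

asPrime-yes : ∀ {n} (pr : Prime (suc n)) → mapMaybe asPrime ((1+ n) ∷ []) ≡ (suc n , [ pr ]) ∷ []
asPrime-yes {n} pr with prime? (suc n)
... | yes _  = refl
... | no ¬pr = contradiction pr ¬pr

asPrime-no : ∀ {n} → ¬ Prime (suc n) → mapMaybe asPrime ((1+ n) ∷ []) ≡ []
asPrime-no {n} ¬pr with prime? (suc n)
... | yes pr = contradiction pr ¬pr
... | no _   = refl

product-++ : ∀ f ps qs k → seq (product f (ps ++ qs)) k ≡ seq (product f ps) k * seq (product f qs) k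
product-++ f []       qs k = sym (*-identityˡ (seq (product f qs) k))
product-++ f (p ∷ ps) qs k = trans (cong (seq (f p) k *_) (product-++ f ps qs k))
  (sym (*-assoc (seq (f p) k) (seq (product f ps) k) (seq (product f qs) k)))

product-primes : ∀ f v k → (∀ p → seq (f p) k ≡ v (value p)) → (∀ {q} → ¬ Prime q → v q ≡ 1ℚ) →
                 ∀ N → seq (product f (mapMaybe asPrime (applyUpTo 1+_ N))) k ≡ ∏₁ v N
product-primes f v k prime nonprime zero    = refl
product-primes f v k prime nonprime (suc N) = begin
  seq (product f (mapMaybe asPrime (applyUpTo 1+_ (suc N)))) k
    ≡⟨ cong (λ l → seq (product f (mapMaybe asPrime l)) k) (applyUpTo-∷ʳ 1+_ N) ⟨
  seq (product f (mapMaybe asPrime (applyUpTo 1+_ N ++ (1+ N) ∷ []))) k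
    ≡⟨ cong (λ l → seq (product f l) k) (mapMaybe-++ asPrime (applyUpTo 1+_ N) ((1+ N) ∷ [])) ⟩
  seq (product f (mapMaybe asPrime (applyUpTo 1+_ N) ++ mapMaybe asPrime ((1+ N) ∷ []))) k
    ≡⟨ product-++ f (mapMaybe asPrime (applyUpTo 1+_ N)) (mapMaybe asPrime ((1+ N) ∷ [])) k ⟩
  seq (product f (mapMaybe asPrime (applyUpTo 1+_ N))) k * seq (product f (mapMaybe asPrime ((1+ N) ∷ []))) k
    ≡⟨ cong₂ _*_ (product-primes f v k prime nonprime N) (last (prime? (suc N))) ⟩
  ∏₁ v N * v (suc N) ∎
  where
  open ≡-Reasoning
  last : Dec (Prime (suc N)) → seq (product f (mapMaybe asPrime ((1+ N) ∷ []))) k ≡ v (suc N)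
  last (yes pr) = trans (cong (λ l → seq (product f l) k) (asPrime-yes pr))
    (trans (*-identityʳ (seq (f (suc N , [ pr ])) k)) (prime (suc N , [ pr ])))
  last (no ¬pr) = trans (cong (λ l → seq (product f l) k) (asPrime-no ¬pr)) (sym (nonprime ¬pr))

-- The 3 counts three errors in C - b X, each at most M ε: the count, the density, and the rounding
-- of X to M. The 2 comes from M ≤ 2 X, which follows from M ≥ 2 and X ≥ M - 1.
quotient-close : ∀ {C X a b ε M} → 0ℚ ≤ b → b ≤ 1ℚ → 1ℚ + 1ℚ ≤ M → 1ℚ ≤ M * ε →
                 ∣ X - M ∣ ≤ 1ℚ → ∣ C - a * M ∣ ≤ M * ε → ∣ a - b ∣ ≤ ε →
                 ∣ C * recip X - b ∣ ≤ (1ℚ + 1ℚ) * (1ℚ + 1ℚ + 1ℚ) * ε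
quotient-close {C} {X} {a} {b} {ε} {M} b≥0 b≤1 M≥2 Mε≥1 X≈M C≈aM a≈b = begin
  ∣ C * u - b ∣
    ≡⟨ cong ∣_∣ (trans (cong (λ t → C * u - t) (trans (sym (*-identityʳ b)) (cong (b *_) (sym Xu≡1))))
         (solve 4 (λ C u b X → C :* u :- b :* (X :* u) := u :* (C :- b :* X)) refl C u b X)) ⟩
  ∣ u * (C - b * X) ∣
    ≡⟨ trans (∣p*q∣≡∣p∣*∣q∣ u (C - b * X)) (cong (_* ∣ C - b * X ∣) (0≤p⇒∣p∣≡p u≥0)) ⟩
  u * ∣ C - b * X ∣
    ≤⟨ *-monoˡ-≤-0≤ u≥0 numerator ⟩
  u * (M * ε + ε * M + 1ℚ)
    ≤⟨ *-monoˡ-≤-0≤ u≥0 (+-monoʳ-≤ (M * ε + ε * M) Mε≥1) ⟩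
  u * (M * ε + ε * M + M * ε)
    ≡⟨ solve 3 (λ u m e → u :* (m :* e :+ e :* m :+ m :* e) := (u :* m) :* ((con 1ℚ :+ con 1ℚ :+ con 1ℚ) :* e)) refl u M ε ⟩
  u * M * ((1ℚ + 1ℚ + 1ℚ) * ε)
    ≤⟨ *-monoʳ-≤-0≤ (*-0≤ (nonNegative⁻¹ (1ℚ + 1ℚ + 1ℚ)) ε≥0) uM≤2 ⟩
  (1ℚ + 1ℚ) * ((1ℚ + 1ℚ + 1ℚ) * ε)
    ≡⟨ *-assoc (1ℚ + 1ℚ) (1ℚ + 1ℚ + 1ℚ) ε ⟨
  (1ℚ + 1ℚ) * (1ℚ + 1ℚ + 1ℚ) * ε ∎
  where
  open ≤-Reasoning
  u = recip X
  ε≥0 : 0ℚ ≤ ε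
  ε≥0 = ≤-trans (0≤∣p∣ (a - b)) a≈b
  M≥0 : 0ℚ ≤ M
  M≥0 = ≤-trans (nonNegative⁻¹ (1ℚ + 1ℚ)) M≥2
  M-X≤1 : M - X ≤ 1ℚ
  M-X≤1 = ≤-trans (≤-trans (p≤∣p∣ (M - X)) (≤-reflexive (∣p-q∣≡∣q-p∣ M X))) X≈M
  M≤2X : M ≤ (1ℚ + 1ℚ) * X
  M≤2X = 0≤⇒≤ (+-0≤ (+-0≤ (p≤q⇒0≤q-p M-X≤1) (p≤q⇒0≤q-p M-X≤1)) (p≤q⇒0≤q-p M≥2))
    (solve 2 (λ m x → (con 1ℚ :+ con 1ℚ) :* x := m :+ (((con 1ℚ :- (m :- x)) :+ (con 1ℚ :- (m :- x))) :+ (m :- (con 1ℚ :+ con 1ℚ)))) refl M X)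
  X>0 : 0ℚ < X
  X>0 = <-≤-trans (positive⁻¹ 1ℚ) (0≤⇒≤ (+-0≤ (p≤q⇒0≤q-p M-X≤1) (p≤q⇒0≤q-p M≥2))
    (solve 2 (λ m x → x := con 1ℚ :+ ((con 1ℚ :- (m :- x)) :+ (m :- (con 1ℚ :+ con 1ℚ)))) refl M X))
  u≥0 : 0ℚ ≤ u
  u≥0 = <⇒≤ (recip>0 X>0)
  Xu≡1 : X * u ≡ 1ℚ
  Xu≡1 = *-recip X>0
  uM≤2 : u * M ≤ 1ℚ + 1ℚ
  uM≤2 = ≤-trans (*-monoˡ-≤-0≤ u≥0 M≤2X) (≤-reflexive (trans
    (solve 2 (λ u x → u :* ((con 1ℚ :+ con 1ℚ) :* x) := (con 1ℚ :+ con 1ℚ) :* (x :* u)) refl u X)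
    (cong ((1ℚ + 1ℚ) *_) Xu≡1)))
  numerator : ∣ C - b * X ∣ ≤ M * ε + ε * M + 1ℚ
  numerator = begin
    ∣ C - b * X ∣
      ≡⟨ cong ∣_∣ (solve 5 (λ C a b m x → C :- b :* x := ((C :- a :* m) :+ (a :- b) :* m) :+ b :* (m :- x)) refl C a b M X) ⟩
    ∣ C - a * M + (a - b) * M + b * (M - X) ∣
      ≤⟨ ≤-trans (∣p+q∣≤∣p∣+∣q∣ (C - a * M + (a - b) * M) (b * (M - X)))
           (+-monoˡ-≤ ∣ b * (M - X) ∣ (∣p+q∣≤∣p∣+∣q∣ (C - a * M) ((a - b) * M))) ⟩
    ∣ C - a * M ∣ + ∣ (a - b) * M ∣ + ∣ b * (M - X) ∣
      ≤⟨ +-mono-≤ (+-mono-≤ C≈aM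
           (≤-trans (≤-reflexive (trans (∣p*q∣≡∣p∣*∣q∣ (a - b) M) (cong (∣ a - b ∣ *_) (0≤p⇒∣p∣≡p M≥0)))) (*-monoʳ-≤-0≤ M≥0 a≈b)))
           (≤-trans (≤-reflexive (∣p*q∣≡∣p∣*∣q∣ b (M - X)))
             (Real.*-mono-≤ 0≤1 (0≤∣p∣ (M - X)) (≤-trans (≤-reflexive (0≤p⇒∣p∣≡p b≥0)) b≤1)
               (≤-trans (≤-reflexive (∣p-q∣≡∣q-p∣ M X)) X≈M))) ⟩
    M * ε + ε * M + 1ℚ * 1ℚ
      ≡⟨ cong (M * ε + ε * M +_) (*-identityˡ 1ℚ) ⟩
    M * ε + ε * M + 1ℚ ∎

module Limits (em : ExcludedMiddle 0ℓ) (h : ℤ₊ × ℙ → Fin 2) where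
  open Coefficients h

  s : ℙ → ℕ → ℚ
  s p = Σ₁ (λ i → coeff (value p) i * recipPow (value p) i)

  -- Any bound independent of n would give convergence; 2 is what `recipPow≤2*gap` and a mass of at
  -- most 1 provide.
  s≤2 : ∀ p n → s p n ≤ ι 2
  s≤2 p n = begin
    s p n
      ≤⟨ Σ₁-mono {n} (λ i _ → *-monoˡ-≤-0≤ (coeff≥0 (value p) (suc i)) (recipPow≤2*gap (value p) {{prime⇒nonTrivial (value-prime p)}} (suc i))) ⟩
    Σ₁ (λ i → coeff (value p) i * (ι 2 * (recipPow (value p) i - recipPow (value p) (suc i)))) n
      ≡⟨ Σ₁-cong {n} (λ i _ → solve 3 (λ c t g → c :* (t :* g) := t :* (c :* g)) refl
           (coeff (value p) (suc i)) (ι 2) (recipPow (value p) (suc i) - recipPow (value p) (suc (suc i)))) ⟩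
    Σ₁ (λ i → ι 2 * (coeff (value p) i * (recipPow (value p) i - recipPow (value p) (suc i)))) n
      ≡⟨ Σ₁-* (ι 2) (λ i → coeff (value p) i * (recipPow (value p) i - recipPow (value p) (suc i))) n ⟩
    ι 2 * mass (coeff (value p)) (recipPow (value p)) n
      ≤⟨ *-monoˡ-≤-0≤ (ι≥0 2) (mass≤1 (coeff≤1 (value p)) (recipPow-weight (value p)) n) ⟩
    ι 2 * 1ℚ
      ≡⟨ *-identityʳ (ι 2) ⟩
    ι 2 ∎
    where open ≤-Reasoning

  -- The increasing partial sums are reflected at 2 to fit `antitone⇒cauchy`. Representing the sum
  -- by its own partial sums makes the k-th term of an Euler factor exactly its truncation at
  -- exponent k.
  σ : ℙ → ℝ
  σ p = mkℝ (s p) λ ε ε>0 → let N , close = tail-cauchy ε ε>0 in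
    N , λ m n N≤m N≤n → subst (_< ε) (flip m n) (close n m N≤n N≤m)
    where
    tail-cauchy : IsCauchy (λ n → ι 2 - s p n)
    tail-cauchy = antitone⇒cauchy em (λ n → ι 2 - s p n)
      (λ m≤n → +-monoʳ-≤ (ι 2) (neg-antimono-≤ (Σ₁-grows (λ i → *-0≤ (coeff≥0 (value p) i) (recip-ι≥0 (value p ^ i))) m≤n)))
      (λ n → p≤q⇒0≤q-p (s≤2 p n))
    flip : ∀ m n → ∣ (ι 2 - s p n) - (ι 2 - s p m) ∣ ≡ ∣ s p m - s p n ∣
    flip m n = cong ∣_∣ (solve 3 (λ t a b → (t :- b) :- (t :- a) := a :- b) refl (ι 2) (s p m) (s p n))

  partialSum-term : ∀ p n k → seq (partialSum (term h p) n) k ≡ s p n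
  partialSum-term p         zero    k = refl
  partialSum-term p@(q , _) (suc n) k = cong₂ _+_ (partialSum-term p n k) (begin
    seq (term h p (1+ n)) k
      ≡⟨ /≡ι*recip (toℕ (h (1+ n , p))) (q ^ suc n) {{ℕₚ.m^n≢0 q (suc n) {{prime⇒nonZero (value-prime p)}}}} ⟩
    ι (toℕ (h (1+ n , p))) * recipPow q (suc n)      ≡⟨ cong (_* recipPow q (suc n)) (coeff-prime p (suc n)) ⟨
    coeff q (suc n) * recipPow q (suc n)             ∎)
    where open ≡-Reasoning

  σ-sum : ∀ p → HasSum (term h p) (σ p)
  σ-sum p ε ε>0@(e , e>0 , _) = let N , close = cauchy (σ p) (½ * e) (half e>0) in
    N , λ n N≤n → close⇒∣-∣< {ε} ε>0 (partialSum (term h p) n) (σ p)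
      (N , λ k N≤k → subst (λ t → ∣ t - s p k ∣ ≤ ½ * e) (sym (partialSum-term p n k)) (<⇒≤ (close n k N≤n N≤k)))

  seq-factor : ∀ p k → seq (factor p (σ p)) k ≡ 1ℚ - mass (coeff (value p)) (recipPow (value p)) k
  seq-factor p@(q , _) k = cong (λ a → 1ℚ - a) (trans
    (sym (Σ₁-* r (λ i → coeff q i * recipPow q i) k))
    (Σ₁-cong {k} λ i _ → trans
      (solve 3 (λ r c w → r :* (c :* w) := c :* (r :* w)) refl r (coeff q (suc i)) (recipPow q (suc i)))
      (cong (coeff q (suc i) *_) (gap (suc i)))))
    where
    instance
      q≢0 : NonZero q
      q≢0 = prime⇒nonZero (value-prime p)
    r = ℤ.+ (q ℕ.∸ 1) / q
    ι-q : ι q ≡ ι (q ℕ.∸ 1) + 1ℚ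
    ι-q = trans (cong ι (sym (ℕₚ.suc-pred q))) (ι-suc (q ℕ.∸ 1))
    gap : ∀ i → r * recipPow q i ≡ recipPow q i - recipPow q (suc i)
    gap i = begin
      r * recipPow q i
        ≡⟨ cong (r *_) (recipPow-suc q i) ⟩
      r * (ι q * recipPow q (suc i))
        ≡⟨ *-assoc r (ι q) (recipPow q (suc i)) ⟨
      r * ι q * recipPow q (suc i)
        ≡⟨ cong (_* recipPow q (suc i)) (/-*-ι (q ℕ.∸ 1) q) ⟩
      ι (q ℕ.∸ 1) * recipPow q (suc i)
        ≡⟨ solve 2 (λ a w → a :* w := (a :+ con 1ℚ) :* w :- w) refl (ι (q ℕ.∸ 1)) (recipPow q (suc i)) ⟩
      (ι (q ℕ.∸ 1) + 1ℚ) * recipPow q (suc i) - recipPow q (suc i)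
        ≡⟨ cong (λ t → t * recipPow q (suc i) - recipPow q (suc i)) ι-q ⟨
      ι q * recipPow q (suc i) - recipPow q (suc i)
        ≡⟨ cong (_- recipPow q (suc i)) (recipPow-suc q i) ⟨
      recipPow q i - recipPow q (suc i) ∎
      where open ≡-Reasoning

  eulerProduct : List ℙ → ℝ
  eulerProduct = product (λ p → factor p (σ p))

  -- The k-th term cuts exponents at k and primes at N; N ≤ k ensures that level k uses all these
  -- primes.
  seq-eulerProduct : ∀ N k → N ℕ.≤ k → seq (eulerProduct (mapMaybe asPrime (applyUpTo 1+_ N))) k ≡ D.sieve k N
  seq-eulerProduct N k N≤k = trans
    (product-primes (λ p → factor p (σ p)) (λ q → 1ℚ - mass (coeff q) (recipPow q) k) k
      (λ p → seq-factor p k) (λ {q} ¬pr → cong (λ a → 1ℚ - a) (mass-zero (recipPow q) (coeff-¬prime ¬pr) k)) N)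
    (∏₁-cong {N} λ i i<N → cong (λ l → 1ℚ - mass (coeff (suc i)) (recipPow (suc i)) l)
      (sym (level-≤ (ℕₚ.≤-trans i<N N≤k))))

  -- With the truncated densities as representative, both limits reduce to comparisons with
  -- `density k` at each late index k.
  L : ℝ
  L = mkℝ density (density-cauchy em)

  -- A sandwich: `D.sieve k N` uses fewer primes than `density k` and higher exponents than
  -- `density N`, so it lies between the two.
  eulerProduct-near : ∀ y (F : Floor em y) k → let N = Floor.⌊x⌋ F in N ℕ.≤ k →
                      ∣ seq (eulerProduct (primesUpTo em y)) k - density k ∣ ≤ density N - density k
  eulerProduct-near y F k N≤k = begin
    ∣ seq (eulerProduct (primesUpTo em y)) k - density k ∣
      ≡⟨ cong (λ l → ∣ seq (eulerProduct (mapMaybe asPrime l)) k - density k ∣) listing ⟩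
    ∣ seq (eulerProduct (mapMaybe asPrime (applyUpTo 1+_ N))) k - density k ∣
      ≡⟨ cong (λ t → ∣ t - density k ∣) (seq-eulerProduct N k N≤k) ⟩
    ∣ D.sieve k N - density k ∣
      ≡⟨ 0≤p⇒∣p∣≡p (p≤q⇒0≤q-p (∏₁-complement-shrinks (D.cover k) (D.cover≥0 k) (D.cover≤1 k) N≤k)) ⟩
    D.sieve k N - density k
      ≤⟨ +-monoˡ-≤ (- density k) (D.sieve-antitone N≤k N) ⟩
    density N - density k ∎
    where
    open Floor F renaming (⌊x⌋ to N)
    open ≤-Reasoning

  eulerProduct-limit : Limit∞ (λ y _ → eulerProduct (primesUpTo em y)) L
  eulerProduct-limit ε ε>0 = fromℕ M , close-beyond
    where
    M = proj₁ (cauchy L (½ * proj₁ ε>0) (half (proj₁ (proj₂ ε>0))))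
    close = proj₂ (cauchy L (½ * proj₁ ε>0) (half (proj₁ (proj₂ ε>0))))

    close-beyond : ∀ y → 0ℝ Real.< y → fromℕ M Real.≤ y → Real.∣ eulerProduct (primesUpTo em y) Real.- L ∣ Real.< ε
    close-beyond y y>0 M≤y = close⇒∣-∣< {ε} ε>0 (eulerProduct (primesUpTo em y)) L
      (N , λ k N≤k → ≤-trans (eulerProduct-near y F k N≤k)
        (≤-trans (p≤∣p∣ (density N - density k)) (<⇒≤ (close N k M≤N (ℕₚ.≤-trans M≤N N≤k)))))
      where
      F = floor em y y>0
      open Floor F renaming (⌊x⌋ to N)
      M≤N = greatest M≤y

  Q≡count : ∀ x (F : Floor em x) → let N = Floor.⌊x⌋ F in ℤ.+ Q h em x / 1 ≡ count N N
  Q≡count x F = trans (ι-def (Q h em x)) (trans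
    (cong (λ l → ι (length (filter (λ n → g h n ℕₚ.≟ 0) l))) (Floor.listing F)) (length-g≡0 {Floor.⌊x⌋ F} {Floor.⌊x⌋ F} ℕₚ.≤-refl))

  Q-limit : Limit∞ (λ x x>0 → fromℕ (Q h em x) ÷ x [ x>0 ]) L
  Q-limit ε ε>0 = fromℕ M , close-beyond
    where
    -- The constant 6 of `quotient-close` times δ is half of the rational below ε, as `close⇒∣-∣<`
    -- requires.
    scale = shrink {b = (1ℚ + 1ℚ) * (1ℚ + 1ℚ + 1ℚ)} (half (proj₁ (proj₂ ε>0))) (positive⁻¹ ((1ℚ + 1ℚ) * (1ℚ + 1ℚ + 1ℚ)))
    δ = proj₁ scale
    δ>0 = proj₁ (proj₂ scale)
    M₁ = proj₁ (cauchy L δ δ>0)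
    C≈ : Eventually (λ N → 1ℚ ≤ ι N * δ × ∣ count N N - density N * ι N ∣ ≤ ι N * δ)
    C≈ = eventually-× (eventually-≤ι* 1ℚ δ>0) (count≈density em δ>0)
    M₂ = proj₁ C≈
    -- Beyond 2 the integer part is comparable to x, beyond M₁ the densities are within δ of each
    -- other, and beyond M₂ both the count error and the rounding error 1 are at most N δ.
    M = 2 ℕ.⊔ (M₁ ℕ.⊔ M₂)

    close-beyond : ∀ x (x>0 : 0ℝ Real.< x) → fromℕ M Real.≤ x → Real.∣ (fromℕ (Q h em x) ÷ x [ x>0 ]) Real.- L ∣ Real.< ε
    close-beyond x x>0 M≤x = close⇒∣-∣< {ε} ε>0 (fromℕ (Q h em x) ÷ x [ x>0 ]) L (K ℕ.⊔ N , close)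
      where
      F = floor em x x>0
      open Floor F renaming (⌊x⌋ to N)
      M≤N = greatest M≤x
      M₁₂≤N = ℕₚ.m⊔n≤o⇒n≤o 2 (M₁ ℕ.⊔ M₂) M≤N
      M₁≤N = ℕₚ.m⊔n≤o⇒m≤o M₁ M₂ M₁₂≤N
      C≈N = proj₂ C≈ N (ℕₚ.m⊔n≤o⇒n≤o M₁ M₂ M₁₂≤N)
      K = proj₁ eventually-near
      two≤N : 1ℚ + 1ℚ ≤ ι N
      two≤N = subst (_≤ ι N) (trans (ι-suc 1) (cong (_+ 1ℚ) ι-1)) (ι-mono (ℕₚ.m⊔n≤o⇒m≤o 2 (M₁ ℕ.⊔ M₂) M≤N))
      close : ∀ k → K ℕ.⊔ N ℕ.≤ k → ∣ (ℤ.+ Q h em x / 1) * recip (seq x k) - density k ∣ ≤ ½ * proj₁ ε>0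
      close k ≤k = subst₂ (λ q b → ∣ q * recip (seq x k) - density k ∣ ≤ b) (sym (Q≡count x F)) (proj₂ (proj₂ scale))
        (quotient-close {count N N} {seq x k} {density N} {density k} {δ} {ι N} (D.sieve≥0 k k) (D.sieve≤1 k k) two≤N
          (proj₁ C≈N) (proj₂ eventually-near k (ℕₚ.m⊔n≤o⇒m≤o K N ≤k)) (proj₂ C≈N)
          (<⇒≤ (proj₂ (cauchy L δ δ>0) N k M₁≤N (ℕₚ.≤-trans M₁≤N (ℕₚ.m⊔n≤o⇒n≤o K N ≤k)))))

theorem4 : (em : ExcludedMiddle 0ℓ) (h : ℤ₊ × ℙ → Fin 2) →
    Σ[ σ ∈ (ℙ → ℝ) ] ((p : ℙ) → HasSum (term h p) (σ p)) ×
    (Σ[ L ∈ ℝ ]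
    Limit∞ (λ y _ → product (λ p → factor p (σ p)) (primesUpTo em y)) L ×
    Limit∞ (λ x x>0 → fromℕ (Q h em x) ÷ x [ x>0 ]) L)
theorem4 em h = σ , σ-sum , L , eulerProduct-limit , Q-limit
  where open Limits em h
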